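{- Let $T_n\subseteq{}^{\omega>}2$ (for $n<\omega$) be trees with no maximal nodes, $\bar{T}=\langle T_n:n<\omega\rangle$, let $2\leq\iota<\omega$ and $k=2\iota$. Let $\mathbf{M}_{\bar{T},k}$, the relation $\sqsubseteq$, the translations $\mathbf{m}+\rho$, the rank ${\rm ndrk}$ and ${\rm NDRK}(\bar{T})$ be as defined in the context. Then: (1) The relation $\sqsubseteq$ is a partial order on $\mathbf{M}_{\bar{T},k}$. (2) If $\mathbf{m},\mathbf{n}\in\mathbf{M}_{\bar{T},k}$, $\mathbf{m}\sqsubseteq\mathbf{n}$ and $\alpha\leq{\rm ndrk}(\mathbf{n})$, then $\alpha\leq{\rm ndrk}(\mathbf{m})$. (3) The function ${\rm ndrk}$ is well defined (that is, if $\beta<\alpha$ and ${\rm ndrk}(\mathbf{m})\geq\alpha$, then ${\rm ndrk}(\mathbf{m})\geq\beta$). (4) If $\mathbf{m}\in\mathbf{M}_{\bar{T},k}$ and $\rho\in{}^{\omega}2$, then ${\rm ndrk}(\mathbf{m})={\rm ndrk}(\mathbf{m}+\rho)$. (5) If $\mathbf{m}\in\mathbf{M}_{\bar{T},k}$, $\nu\in u_{\mathbf{m}}$ and ${\rm ndrk}(\mathbf{m})\geq\omega_1$, then there is $\mathbf{n}\in\mathbf{M}_{\bar{T},k}$ such that $\mathbf{m}\sqsubseteq\mathbf{n}$, ${\rm ndrk}(\mathbf{n})\geq\omega_1$ and $|\{\eta\in u_{\mathbf{n}}:\nu\vartriangleleft\eta\}|\geq 2$. (6) If $\mathbf{m}\in\mathbf{M}_{\bar{T},k}$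 and $\infty>{\rm ndrk}(\mathbf{m})=\beta>\alpha$, then there is $\mathbf{n}\in\mathbf{M}_{\bar{T},k}$ such that $\mathbf{m}\sqsubseteq\mathbf{n}$ and ${\rm ndrk}(\mathbf{n})=\alpha$. (7) If ${\rm NDRK}(\bar{T})\geq\omega_1$, then ${\rm NDRK}(\bar{T})=\infty$. (8) Assume $\mathbf{m}\in\mathbf{M}_{\bar{T},k}$ and $u'\subseteq u_{\mathbf{m}}$, $|u'|\geq 2$. Put $\ell'=\ell_{\mathbf{m}}$, $h'_i=h^{\mathbf{m}}_i\restriction(u')^{\langle2\rangle}$ and $g'_i=g^{\mathbf{m}}_i\restriction(u')^{\langle2\rangle}$ (for $i<\iota$), and let $\mathbf{m}\restriction u'=(\ell',u',\bar{h}',\bar{g}')$ where $\bar h'=\langle h'_i:i<\iota\rangle$ and $\bar g'=\langle g'_i:i<\iota\rangle$. Then $\mathbf{m}\restriction u'\in\mathbf{M}_{\bar{T},k}$ and ${\rm ndrk}(\mathbf{m})\leq{\rm ndrk}(\mathbf{m}\restriction u')$.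
   Context: ${}^{\omega>}2$ is the set of finite 0-1 sequences, ${}^{\ell}2$ those of length $\ell$; $+$ is coordinatewise addition modulo 2; $\nu\vartriangleleft\eta$ means that $\nu$ is a proper initial segment of $\eta$. For a set $u$, $u^{\langle2\rangle}=\{(x,y)\in u\times u:x\neq y\}$. $\mathbf{M}_{\bar{T},k}$ consists of all tuples $\mathbf{m}=(\ell_{\mathbf{m}},u_{\mathbf{m}},\bar{h}_{\mathbf{m}},\bar{g}_{\mathbf{m}})=(\ell,u,\bar{h},\bar{g})$ such that: (a) $0<\ell<\omega$, $u\subseteq{}^{\ell}2$ and $2\leq|u|$; (b) $\bar{h}=\langle h_i:i<\iota\rangle$, $\bar{g}=\langle g_i:i<\iota\rangle$, with $h_i:u^{\langle2\rangle}\to\omega$ and $g_i:u^{\langle2\rangle}\to\bigcup_{n<\omega}(T_n\cap{}^{\ell}2)$ for each $i<\iota$; (c) $g_i(\eta,\nu)\in T_{h_i(\eta,\nu)}\cap{}^{\ell}2$ for all $(\eta,\nu)\in u^{\langle2\rangle}$, $i<\iota$; (d) $\eta+g_i(\eta,\nu)=\nu+g_i(\nu,\eta)$ for all $(\eta,\nu)\in u^{\langle2\rangle}$, $i<\iota$; (e) for any $(\eta,\nu)\in u^{\langle2\rangle}$ there are no repetitions in the sequence $\langle g_i(\eta,\nu),g_i(\nu,\eta):i<\iota\rangle$. The components of $\bar h_{\mathbf m},\bar g_{\mathbf m}$ are written $h^{\mathbf m}_i,g^{\mathbf m}_i$. Translations: for $\mathbf{m}=(\ell,u,\bar{h},\bar{g})\in\mathbf{M}_{\bar{T},k}$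 and $\rho\in{}^{\ell}2$, $\mathbf{m}+\rho=(\ell,u',\bar{h}',\bar{g}')$ where $u'=\{\eta+\rho:\eta\in u\}$, $h'_i(\eta+\rho,\nu+\rho)=h_i(\eta,\nu)$ and $g'_i(\eta+\rho,\nu+\rho)=g_i(\eta,\nu)$ for $(\eta,\nu)\in u^{\langle2\rangle}$, $i<\iota$. For $\rho\in{}^{\omega}2$, $\mathbf{m}+\rho=\mathbf{m}+(\rho\restriction\ell)$. Extension: $\mathbf{m}\sqsubseteq\mathbf{n}$ iff $\ell_{\mathbf{m}}\leq\ell_{\mathbf{n}}$, $u_{\mathbf{m}}=\{\eta\restriction\ell_{\mathbf{m}}:\eta\in u_{\mathbf{n}}\}$, and for every $(\eta,\nu)\in(u_{\mathbf{n}})^{\langle2\rangle}$ with $\eta\restriction\ell_{\mathbf{m}}\neq\nu\restriction\ell_{\mathbf{m}}$ and each $i<\iota$: $h^{\mathbf{m}}_i(\eta\restriction\ell_{\mathbf{m}},\nu\restriction\ell_{\mathbf{m}})=h^{\mathbf{n}}_i(\eta,\nu)$ and $g^{\mathbf{m}}_i(\eta\restriction\ell_{\mathbf{m}},\nu\restriction\ell_{\mathbf{m}})=g^{\mathbf{n}}_i(\eta,\nu)\restriction\ell_{\mathbf{m}}$. Rank ${\rm ndrk}:\mathbf{M}_{\bar{T},k}\to{\rm ON}\cup\{\infty\}$, defined by declaring inductively when ${\rm ndrk}(\mathbf{m})\geq\alpha$: ${\rm ndrk}(\mathbf{m})\geq0$ always; for limit $\alpha$, ${\rm ndrk}(\mathbf{m})\geq\alpha$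 iff ${\rm ndrk}(\mathbf{m})\geq\beta$ for all $\beta<\alpha$; ${\rm ndrk}(\mathbf{m})\geq\beta+1$ iff for every $\nu\in u_{\mathbf{m}}$ there is $\mathbf{n}\in\mathbf{M}_{\bar{T},k}$ with $\ell_{\mathbf{n}}>\ell_{\mathbf{m}}$, $\mathbf{m}\sqsubseteq\mathbf{n}$, ${\rm ndrk}(\mathbf{n})\geq\beta$ and $|\{\eta\in u_{\mathbf{n}}:\nu\vartriangleleft\eta\}|\geq2$; ${\rm ndrk}(\mathbf{m})=\infty$ iff ${\rm ndrk}(\mathbf{m})\geq\alpha$ for all ordinals $\alpha$ (otherwise ${\rm ndrk}(\mathbf m)$ is the largest $\alpha$ with ${\rm ndrk}(\mathbf m)\geq\alpha$). ${\rm NDRK}(\bar{T})=\sup\{{\rm ndrk}(\mathbf{m})+1:\mathbf{m}\in\mathbf{M}_{\bar{T},k}\}$ (with $\infty+1=\infty$). -}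

module Defs where

open import Level using (0ℓ) renaming (suc to lsuc)
open import Axiom.ExcludedMiddle using (ExcludedMiddle)
open import Data.Bool using (Bool; _xor_)
open import Data.Bool.Properties using (xor-assoc; xor-comm; xor-same; xor-identityʳ)
open import Data.Fin using (Fin; toℕ)
open import Data.List using (List)
open import Data.List.Relation.Binary.Prefix.Heterogeneous using (Prefix)
open import Data.Nat as ℕ using (ℕ)
open import Data.Product using (Σ; Σ-syntax; ∃; ∃₂; ∃-syntax; _×_; _,_; proj₁; proj₂)
open import Data.Sum using (_⊎_; [_,_]′)
open import Data.Vec using (Vec; []; _∷_; cast; tabulate; toList; truncate; zipWith)
open import Function using (_∘_; Injective)
open import Function.Bundles using (Injection)
open import Induction.WellFounded using (Acc; acc; WellFounded)
open import Relation.Binary using (Rel; StrictTotalOrder)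
open import Relation.Binary.Morphism.Structures using (IsOrderIsomorphism)
open import Relation.Binary.PropositionalEquality
open import Relation.Nullary using (¬_; yes; no)
open import Relation.Nullary.Construct.Add.Supremum using (_⁺; [_]; ⊤⁺)
open import Relation.Unary using (Pred; _∈_; _⊆_; _≐_)
import Relation.Binary.Construct.Add.Supremum.Equality as SupremumEquality
import Relation.Binary.Construct.Add.Supremum.NonStrict as SupremumNonStrict
import Relation.Binary.Construct.Add.Supremum.Strict as SupremumStrict
import Relation.Binary.Construct.On as On

------------------------------------------------------------------------
-- Ordinals

-- Ordinals are represented by well-ordered (setoid) types and compared by
-- order type.
record Ordinal : Set₁ where
  field
    strictTotalOrder : StrictTotalOrder 0ℓ 0ℓ 0ℓ
  open StrictTotalOrder strictTotalOrder public
  field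
    wellFounded : WellFounded _<_

infix 4 _≈ᵒ_ _<ᵒ_ _≤ᵒ_

_≈ᵒ_ : Rel Ordinal 0ℓ
α ≈ᵒ β = Σ[ f ∈ (A.Carrier → B.Carrier) ] IsOrderIsomorphism A._≈_ B._≈_ A._<_ B._<_ f
  where
  module A = Ordinal α
  module B = Ordinal β

segment : (α : Ordinal) → Ordinal.Carrier α → Ordinal
segment α a = record
  { strictTotalOrder = On.strictTotalOrder A.strictTotalOrder element
  ; wellFounded      = On.wellFounded element A.wellFounded
  }
  where
  module A = Ordinal α
  element : (∃[ x ] x A.< a) → A.Carrier
  element = proj₁

_<ᵒ_ : Rel Ordinal 0ℓ
α <ᵒ β = ∃[ b ] α ≈ᵒ segment β b

_≤ᵒ_ : Rel Ordinal 0ℓ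
α ≤ᵒ β = α <ᵒ β ⊎ α ≈ᵒ β

IsZero : Pred Ordinal 0ℓ
IsZero α = ¬ Ordinal.Carrier α

sucᵒ : Ordinal → Ordinal
sucᵒ α = record
  { strictTotalOrder = record
      { isStrictTotalOrder = <⁺-isStrictTotalOrder A.isStrictTotalOrder }
  ; wellFounded = wf⁺
  }
  where
  module A = Ordinal α
  open SupremumStrict A._<_

  acc-[_] : ∀ {x} → Acc A._<_ x → Acc _<⁺_ [ x ]
  acc-[ acc rs ] = acc λ { [ y<x ] → acc-[ rs y<x ] }

  wf⁺ : WellFounded _<⁺_
  wf⁺ [ x ] = acc-[ A.wellFounded x ]
  wf⁺ ⊤⁺    = acc λ { [ x ]<⊤⁺ → acc-[ A.wellFounded x ] }

IsLimit : Pred Ordinal (lsuc 0ℓ)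
IsLimit α = ¬ IsZero α × ¬ (∃[ β ] α ≈ᵒ sucᵒ β)

Countable : Pred Ordinal 0ℓ
Countable α = Injection (StrictTotalOrder.Eq.setoid (Ordinal.strictTotalOrder α)) (setoid ℕ)

-- Characterizes ω₁ up to ≈ᵒ.  By excluded middle such an ordinal exists: the
-- Bool-valued well-orders of subsets of ℕ, compared by order type.
IsFirstUncountable : Pred Ordinal (lsuc 0ℓ)
IsFirstUncountable α = ¬ Countable α × (∀ β → β <ᵒ α → Countable β)

-- ON ∪ {∞}, where ∞ is ⊤⁺.
ON∞ : Set₁
ON∞ = Ordinal ⁺

open SupremumEquality _≈ᵒ_ public using (_≈⁺_)
open SupremumNonStrict _≤ᵒ_ public using (_≤⁺_)

suc⁺ : ON∞ → ON∞
suc⁺ [ α ] = [ sucᵒ α ]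
suc⁺ ⊤⁺    = ⊤⁺

IsSupremum : {I : Set₁} → (I → ON∞) → Pred ON∞ (lsuc 0ℓ)
IsSupremum F v = (∀ i → F i ≤⁺ v) × (∀ w → (∀ i → F i ≤⁺ w) → v ≤⁺ w)

-- Any family with an upper bound in ON has a least one, so when no ordinal is
-- a supremum the supremum in ON ∪ {∞} is ∞.
supremum : ExcludedMiddle (lsuc 0ℓ) → {I : Set₁} → (I → ON∞) → ON∞
supremum em F with em {∃[ α ] IsSupremum F [ α ]}
... | yes (α , _) = [ α ]
... | no  _       = ⊤⁺

------------------------------------------------------------------------
-- Sequences and trees

infix 4 _◁_

_◁_ : Rel (List Bool) 0ℓ
ν ◁ η = Prefix _≡_ ν η × ν ≢ η

IsTree : Pred (Pred (List Bool) 0ℓ) 0ℓ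
IsTree T = ∀ {ν η} → ν ◁ η → η ∈ T → ν ∈ T

NoMaximalNodes : Pred (Pred (List Bool) 0ℓ) 0ℓ
NoMaximalNodes T = ∀ {ν} → ν ∈ T → ∃[ η ] η ∈ T × ν ◁ η

infixl 6 _⊕_

_⊕_ : ∀ {ℓ} → Vec Bool ℓ → Vec Bool ℓ → Vec Bool ℓ
_⊕_ = zipWith _xor_

_↾_ : (ℕ → Bool) → (ℓ : ℕ) → Vec Bool ℓ
ρ ↾ ℓ = tabulate {n = ℓ} (ρ ∘ toℕ)

⊕-cancelʳ : ∀ {ℓ} (η ρ : Vec Bool ℓ) → (η ⊕ ρ) ⊕ ρ ≡ η
⊕-cancelʳ []      []      = refl
⊕-cancelʳ (x ∷ η) (r ∷ ρ) = cong₂ _∷_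
  (trans (xor-assoc x r r) (trans (cong (x xor_) (xor-same r)) (xor-identityʳ x)))
  (⊕-cancelʳ η ρ)

⊕-swapʳ : ∀ {ℓ} (η ρ γ : Vec Bool ℓ) → (η ⊕ ρ) ⊕ γ ≡ (η ⊕ γ) ⊕ ρ
⊕-swapʳ []      []      []      = refl
⊕-swapʳ (x ∷ η) (r ∷ ρ) (c ∷ γ) = cong₂ _∷_
  (trans (xor-assoc x r c) (trans (cong (x xor_) (xor-comm r c)) (sym (xor-assoc x c r))))
  (⊕-swapʳ η ρ γ)

⊕-injectiveˡ : ∀ {ℓ} (ρ : Vec Bool ℓ) {η ν} → η ⊕ ρ ≡ ν ⊕ ρ → η ≡ ν
⊕-injectiveˡ ρ {η} {ν} eq =
  trans (sym (⊕-cancelʳ η ρ)) (trans (cong (_⊕ ρ) eq) (⊕-cancelʳ ν ρ))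

image : {A B : Set} → (A → B) → Pred A 0ℓ → Pred B 0ℓ
image f P y = ∃[ x ] x ∈ P × f x ≡ y

-- |P| ≥ 2.
AtLeastTwo : {A : Set} → Pred (Pred A 0ℓ) 0ℓ
AtLeastTwo P = ∃₂ λ x y → x ∈ P × y ∈ P × x ≢ y

-- The membership proofs are irrelevant, so that a function on u ⟨2⟩ depends
-- only on the two elements.
record _⟨2⟩ {A : Set} (u : Pred A 0ℓ) : Set where
  constructor pair
  field
    fst : A
    snd : A
    .fst∈ : fst ∈ u
    .snd∈ : snd ∈ u
    .fst≢snd : fst ≢ snd

open _⟨2⟩ public

swap : {A : Set} {u : Pred A 0ℓ} → u ⟨2⟩ → u ⟨2⟩
swap (pair x y x∈ y∈ x≢y) = pair y x y∈ x∈ (x≢y ∘ sym)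

------------------------------------------------------------------------
-- Tuples (ℓ , u , h̄ , ḡ)

record Tuple (ι : ℕ) : Set₁ where
  field
    ℓ : ℕ
    u : Pred (Vec Bool ℓ) 0ℓ
    h : Fin ι → u ⟨2⟩ → ℕ
    g : Fin ι → u ⟨2⟩ → Vec Bool ℓ

open Tuple public

module _ {ι : ℕ} where

  infixl 6 _+ᵗ_

  -- As ⊕ ρ is an involution, precomposing with it gives
  -- h′ i (η ⊕ ρ , ν ⊕ ρ) = h i (η , ν), and likewise for g′.
  _+ᵗ_ : (m : Tuple ι) → Vec Bool (ℓ m) → Tuple ι
  m +ᵗ ρ = record
    { ℓ = ℓ m
    ; u = u′
    ; h = λ i → h m i ∘ back
    ; g = λ i → g m i ∘ back
    }
    where
    u′ : Pred (Vec Bool (ℓ m)) 0ℓ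
    u′ = image (_⊕ ρ) (u m)

    back∈ : ∀ {ζ} → ζ ∈ u′ → ζ ⊕ ρ ∈ u m
    back∈ (η , η∈ , refl) = subst (_∈ u m) (sym (⊕-cancelʳ η ρ)) η∈

    back : u′ ⟨2⟩ → u m ⟨2⟩
    back (pair x y x∈ y∈ x≢y) =
      pair (x ⊕ ρ) (y ⊕ ρ) (back∈ x∈) (back∈ y∈) (x≢y ∘ ⊕-injectiveˡ ρ)

  restrict : (m : Tuple ι) (u′ : Pred (Vec Bool (ℓ m)) 0ℓ) → u′ ⊆ u m → Tuple ι
  restrict m u′ u′⊆u = record
    { ℓ = ℓ m
    ; u = u′
    ; h = λ i → h m i ∘ include
    ; g = λ i → g m i ∘ include
    }
    where
    include : u′ ⟨2⟩ → u m ⟨2⟩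
    include (pair x y x∈ y∈ x≢y) = pair x y (u′⊆u x∈) (u′⊆u y∈) x≢y

  infix 4 _≋_ _⊑_

  -- Equality of tuples as set-theoretic objects; propositional equality would
  -- distinguish extensionally equal u, h̄, ḡ.
  record _≋_ (m n : Tuple ι) : Set where
    field
      ℓ≡ : ℓ m ≡ ℓ n
      u≡ : image (cast ℓ≡) (u m) ≐ u n
      h≡ : ∀ (p : u m ⟨2⟩) (q : u n ⟨2⟩) →
           cast ℓ≡ (fst p) ≡ fst q → cast ℓ≡ (snd p) ≡ snd q →
           ∀ i → h m i p ≡ h n i q
      g≡ : ∀ (p : u m ⟨2⟩) (q : u n ⟨2⟩) →
           cast ℓ≡ (fst p) ≡ fst q → cast ℓ≡ (snd p) ≡ snd q →
           ∀ i → cast ℓ≡ (g m i p) ≡ g n i q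

  -- q is a pair (η , ν) from u n whose restrictions to ℓ m differ, and p is
  -- the pair (η ↾ ℓ m , ν ↾ ℓ m), which lies in u m ⟨2⟩ by u≡.
  record _⊑_ (m n : Tuple ι) : Set where
    field
      ℓ≤ : ℓ m ℕ.≤ ℓ n
      u≡ : u m ≐ image (truncate ℓ≤) (u n)
      h≡ : ∀ (p : u m ⟨2⟩) (q : u n ⟨2⟩) →
           truncate ℓ≤ (fst q) ≡ fst p → truncate ℓ≤ (snd q) ≡ snd p →
           ∀ i → h m i p ≡ h n i q
      g≡ : ∀ (p : u m ⟨2⟩) (q : u n ⟨2⟩) →
           truncate ℓ≤ (fst q) ≡ fst p → truncate ℓ≤ (snd q) ≡ snd p →
           ∀ i → g m i p ≡ truncate ℓ≤ (g n i q)

  -- u n has at least two elements properly extending ν.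
  Splits : ∀ {ℓ₀} → Vec Bool ℓ₀ → Tuple ι → Set
  Splits ν n = AtLeastTwo λ η → η ∈ u n × toList ν ◁ toList η

------------------------------------------------------------------------
-- The family 𝐌 and the rank

module _ (T : ℕ → Pred (List Bool) 0ℓ) (ι : ℕ) where

  -- Membership in 𝐌_{T̄,k} for k = 2ι.  That the values of g i lie in
  -- ⋃ₙ (T n ∩ ^ℓ 2) follows from g∈T.
  record Is𝐌 (m : Tuple ι) : Set where
    field
      ℓ>0   : 0 ℕ.< ℓ m
      ∣u∣≥2 : AtLeastTwo (u m)
      g∈T   : ∀ i p → toList (g m i p) ∈ T (h m i p)
      sums  : ∀ i p → fst p ⊕ g m i p ≡ snd p ⊕ g m i (swap p)
      norep : ∀ p → Injective _≡_ _≡_ [ (λ i → g m i p) , (λ i → g m i (swap p)) ]′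

  𝐌 : Set₁
  𝐌 = Σ (Tuple ι) Is𝐌

module _ {T : ℕ → Pred (List Bool) 0ℓ} {ι : ℕ} where

  infixl 6 _+ᶠ_ _+ᴹ_
  infix 4 _ndrk≥_

  _+ᶠ_ : (m : 𝐌 T ι) → Vec Bool (ℓ (proj₁ m)) → 𝐌 T ι
  (m , m∈) +ᶠ ρ = m +ᵗ ρ , record
    { ℓ>0   = M.ℓ>0
    ; ∣u∣≥2 = let (x , y , x∈ , y∈ , x≢y) = M.∣u∣≥2 in
              x ⊕ ρ , y ⊕ ρ , (x , x∈ , refl) , (y , y∈ , refl) , x≢y ∘ ⊕-injectiveˡ ρ
    ; g∈T   = λ i p → M.g∈T i _
    ; sums  = λ i p → ⊕-injectiveˡ ρ
              (trans (sym (⊕-swapʳ (fst p) ρ _))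
                (trans (M.sums i _) (⊕-swapʳ (snd p) ρ _)))
    ; norep = λ p → M.norep _
    }
    where module M = Is𝐌 m∈

  _+ᴹ_ : 𝐌 T ι → (ℕ → Bool) → 𝐌 T ι
  m +ᴹ ρ = m +ᶠ (ρ ↾ ℓ (proj₁ m))

  -- The three conditions on α are mutually exclusive, so each constructor is an
  -- "if and only if" clause for its kind of ordinal.
  data _ndrk≥_ (m : 𝐌 T ι) (α : Ordinal) : Set₁ where
    zero  : IsZero α → m ndrk≥ α
    limit : IsLimit α → (∀ β → β <ᵒ α → m ndrk≥ β) → m ndrk≥ α
    succ  : ∀ β → α ≈ᵒ sucᵒ β →
            (∀ ν → ν ∈ u (proj₁ m) → Σ[ n ∈ 𝐌 T ι ]
              ℓ (proj₁ m) ℕ.< ℓ (proj₁ n) × proj₁ m ⊑ proj₁ n × n ndrk≥ β × Splits ν (proj₁ n)) →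
            m ndrk≥ α

  IsNdrk : 𝐌 T ι → ON∞ → Set₁
  IsNdrk m ⊤⁺    = ∀ α → m ndrk≥ α
  IsNdrk m [ α ] = m ndrk≥ α × (∀ β → m ndrk≥ β → β ≤ᵒ α)

  -- A value satisfying IsNdrk; the second clause is a default that is used
  -- only if there is none.
  ndrk : ExcludedMiddle (lsuc 0ℓ) → 𝐌 T ι → ON∞
  ndrk em m with em {Σ ON∞ (IsNdrk m)}
  ... | yes (v , _) = v
  ... | no  _       = ⊤⁺

NDRK : ExcludedMiddle (lsuc 0ℓ) → (ℕ → Pred (List Bool) 0ℓ) → ℕ → ON∞
NDRK em T ι = supremum em (λ (m : 𝐌 T ι) → suc⁺ (ndrk em m))

{-# OPTIONS --safe #-}

-- Ordinals are compared classically: ≺ is well-founded, transitive and extensional,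
-- hence total.  Monotonicity of ndrk ≥ α in α needs no induction on α, only on the
-- derivation, because ndrk ≥ α passes down along ⊑; the rank is then read off the
-- least α at which ndrk ≥ α fails.  For (5) and (7), tuples can be coded by natural
-- numbers up to ≋, so by regularity of ω₁ a class of tuples all of rank < ω₁ has its
-- ranks bounded below ω₁.

module Submission where

open import Defs
open import Level using (0ℓ; Lift; lift; lower) renaming (suc to lsuc)
open import Axiom.DoubleNegationElimination using (em⇒dne)
open import Axiom.ExcludedMiddle using (ExcludedMiddle)
open import Data.Bool using (Bool; true; false; _xor_; if_then_else_)
open import Data.Empty using (⊥-elim)
open import Data.Fin using (Fin; zero; suc)
open import Data.List using (List; length)
open import Data.List.Relation.Binary.Prefix.Heterogeneous using (Prefix; []; _∷_)
open import Data.Nat as ℕ using (ℕ; zero; suc; z≤n; s≤s; _≤_)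
open import Data.Nat.Induction using (<-wellFounded)
open import Data.Product using (Σ; Σ-syntax; ∃; ∃-syntax; _×_; _,_; proj₁; proj₂)
open import Data.Sum as Sum using (_⊎_; inj₁; inj₂)
open import Data.Unit using (⊤)
open import Data.Vec using (Vec; []; _∷_; cast; toList; truncate)
open import Data.Vec.Properties
  using (truncate-refl; truncate-trans; truncate-irrelevant; cast-is-id; length-toList)
open import Function using (_∘_; _on_; id)
open import Function.Bundles using (Injection)
open import Induction.WellFounded using (Acc; acc; WellFounded)
open import Relation.Binary using (IsPartialOrder; tri<; tri≈; tri>)
open import Relation.Binary.Construct.Add.Supremum.Equality using ([_]; ⊤⁺≈⊤⁺)
open import Relation.Binary.Construct.Add.Supremum.NonStrict using ([_]; _≤⊤⁺)
open import Relation.Binary.Construct.Add.Supremum.Strict using ([_]; [_]<⊤⁺)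
open import Relation.Binary.Morphism.Structures using (IsOrderIsomorphism)
open import Relation.Binary.PropositionalEquality
open import Relation.Nullary using (¬_; yes; no; contradiction)
open import Relation.Nullary.Construct.Add.Supremum using ([_]; ⊤⁺)
open import Relation.Nullary.Decidable using (map′)
open import Relation.Nullary.Negation.Core using (contradiction-irr)
open import Relation.Unary using (Pred; _∈_; _⊆_; _≐_)
import Data.Nat.Properties as ℕ

-- The statements about ω₁ rest on one clash. If no extension splitting `ν` had rank at least ω₁,
-- then `ndrk≥ b` would fail for all of them at a single b < ω₁. But ω₁ is a limit, so a tuple of
-- rank at least ω₁ has rank at least b + 1, and that yields a splitting extension of rank at least
-- b. The obstacle to numerical codes is that `u` is an arbitrary predicate on a finite cube, while
-- `h` and `g` are defined only on pairs from `u`. Excluded middle turns all three into total tables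
-- on the cube, and these are finite data. Codes need to be faithful only up to `⊑`, since `ndrk≥`
-- is transported along it.

private
  variable
    l l′ ι : ℕ
    T : ℕ → Pred (List Bool) 0ℓ
    α β γ : Ordinal

-- Ordinals

-- The relations of Defs unfold to Σ-types from which the two ordinals cannot be
-- inferred; these records can be used with implicit ordinals.
record _≅_ (α β : Ordinal) : Set where
  constructor mk≅
  private
    module A = Ordinal α
    module B = Ordinal β
  field
    to         : A.Carrier → B.Carrier
    to-cong    : ∀ {x y} → x A.≈ y → to x B.≈ to y
    to-mono    : ∀ {x y} → x A.< y → to x B.< to y
    surjective : ∀ y → ∃[ x ] to x B.≈ y

  from : B.Carrier → A.Carrier
  from y = proj₁ (surjective y)

  to-from : ∀ y → to (from y) B.≈ y
  to-from y = proj₂ (surjective y)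

  injective : ∀ {x y} → to x B.≈ to y → x A.≈ y
  injective {x} {y} eq with A.compare x y
  ... | tri< x<y _ _ = contradiction (to-mono x<y) (B.irrefl eq)
  ... | tri≈ _ x≈y _ = x≈y
  ... | tri> _ _ y<x = contradiction (to-mono y<x) (B.irrefl (B.Eq.sym eq))

  cancel : ∀ {x y} → to x B.< to y → x A.< y
  cancel {x} {y} lt with A.compare x y
  ... | tri< x<y _ _ = x<y
  ... | tri≈ _ x≈y _ = contradiction lt (B.irrefl (to-cong x≈y))
  ... | tri> _ _ y<x = contradiction (to-mono y<x) (B.asym lt)

record _≺_ (α β : Ordinal) : Set where
  constructor below
  field
    bound : Ordinal.Carrier β
    iso   : α ≅ segment β bound

_≼_ : (α β : Ordinal) → Set
α ≼ β = α ≺ β ⊎ α ≅ β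

infix 4 _≅_ _≺_ _≼_

≅⇒≈ᵒ : α ≅ β → α ≈ᵒ β
≅⇒≈ᵒ {α} {β} e = to , record
  { isOrderMonomorphism = record
      { isOrderHomomorphism = record { cong = to-cong ; mono = to-mono }
      ; injective = injective
      ; cancel    = cancel
      }
  ; surjective = λ y → from y , λ z≈x → Ordinal.Eq.trans β (to-cong z≈x) (to-from y)
  }
  where open _≅_ e

≈ᵒ⇒≅ : ∀ α β → α ≈ᵒ β → α ≅ β
≈ᵒ⇒≅ α β (f , f-iso) = mk≅ f F.cong F.mono
  λ y → let (x , fx≈y) = F.surjective y in x , fx≈y (Ordinal.Eq.refl α)
  where module F = IsOrderIsomorphism f-iso

≺⇒<ᵒ : α ≺ β → α <ᵒ β
≺⇒<ᵒ (below b e) = b , ≅⇒≈ᵒ e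

<ᵒ⇒≺ : ∀ α β → α <ᵒ β → α ≺ β
<ᵒ⇒≺ α β (b , e) = below b (≈ᵒ⇒≅ α (segment β b) e)

≼⇒≤ᵒ : α ≼ β → α ≤ᵒ β
≼⇒≤ᵒ = Sum.map ≺⇒<ᵒ ≅⇒≈ᵒ

≤ᵒ⇒≼ : ∀ α β → α ≤ᵒ β → α ≼ β
≤ᵒ⇒≼ α β = Sum.map (<ᵒ⇒≺ α β) (≈ᵒ⇒≅ α β)

≅-refl : α ≅ α
≅-refl {α} = mk≅ id id id (λ x → x , Ordinal.Eq.refl α)

≈ᵒ-refl : ∀ α → α ≈ᵒ α
≈ᵒ-refl α = ≅⇒≈ᵒ (≅-refl {α})

≅-sym : α ≅ β → β ≅ α
≅-sym {α} {β} e = mk≅ from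
  (λ x≈y → injective (B.Eq.trans (to-from _) (B.Eq.trans x≈y (B.Eq.sym (to-from _)))))
  (λ x<y → cancel (B.<-respˡ-≈ (B.Eq.sym (to-from _)) (B.<-respʳ-≈ (B.Eq.sym (to-from _)) x<y)))
  (λ x → to x , injective (to-from (to x)))
  where
  module B = Ordinal β
  open _≅_ e

≅-trans : α ≅ β → β ≅ γ → α ≅ γ
≅-trans {α} {β} {γ} e e′ = mk≅ (E′.to ∘ E.to) (E′.to-cong ∘ E.to-cong) (E′.to-mono ∘ E.to-mono)
  (λ y → E.from (E′.from y) ,
         Ordinal.Eq.trans γ (E′.to-cong (E.to-from (E′.from y))) (E′.to-from y))
  where
  module E  = _≅_ e
  module E′ = _≅_ e′

segment-cong : (e : α ≅ β) (a : Ordinal.Carrier α) → segment α a ≅ segment β (_≅_.to e a)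
segment-cong {α} {β} e a = mk≅ (λ (x , x<a) → to x , to-mono x<a) to-cong to-mono
  (λ (y , y<fa) → (from y , cancel (Ordinal.<-respˡ-≈ β (Ordinal.Eq.sym β (to-from y)) y<fa)) , to-from y)
  where open _≅_ e

module _ (α : Ordinal) where
  private module A = Ordinal α

  segment-≈ : ∀ {a b} → a A.≈ b → segment α a ≅ segment α b
  segment-≈ {a} {b} a≈b = mk≅ (λ (x , x<a) → x , A.<-respʳ-≈ a≈b x<a) id id
    (λ (y , y<b) → (y , A.<-respʳ-≈ (A.Eq.sym a≈b) y<b) , A.Eq.refl)

  segment-segment : ∀ {a} (x : Ordinal.Carrier (segment α a)) →
                    segment (segment α a) x ≅ segment α (proj₁ x)
  segment-segment {a} (x , x<a) = mk≅ (λ ((y , _) , y<x) → y , y<x) id id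
    (λ (y , y<x) → ((y , A.trans y<x x<a) , y<x) , A.Eq.refl)

  segment-< : ∀ {a b} → a A.< b → segment α a ≺ segment α b
  segment-< {a} a<b = below (a , a<b) (≅-sym (segment-segment (a , a<b)))

  segment≺ : ∀ a → segment α a ≺ α
  segment≺ a = below a ≅-refl

≺-respˡ : α ≅ β → α ≺ γ → β ≺ γ
≺-respˡ e (below c e′) = below c (≅-trans (≅-sym e) e′)

≺-respʳ : β ≅ γ → α ≺ β → α ≺ γ
≺-respʳ e (below b e′) = below (_≅_.to e b) (≅-trans e′ (segment-cong e b))

≺-trans : α ≺ β → β ≺ γ → α ≺ γ
≺-trans {γ = γ} α<β (below c e) with below x e′ ← ≺-respʳ e α<β =
  below (proj₁ x) (≅-trans e′ (segment-segment γ x))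

-- Whatever lies below `α` is isomorphic to a segment of `α`, and whatever lies below a segment is
-- again one with a smaller bound. Accessibility of elements inside `α` therefore becomes
-- accessibility of ordinals.
≺-wellFounded : WellFounded _≺_
≺-wellFounded α = acc λ { (below a e) → acc-resp e (acc-segment (A.wellFounded a)) }
  where
  module A = Ordinal α

  acc-resp : ∀ {β γ} → β ≅ γ → Acc _≺_ γ → Acc _≺_ β
  acc-resp e (acc rs) = acc λ δ<β → rs (≺-respʳ e δ<β)

  acc-segment : ∀ {a} → Acc A._<_ a → Acc _≺_ (segment α a)
  acc-segment (acc rs) = acc λ { (below (x , x<a) e) →
    acc-resp (≅-trans e (segment-segment α (x , x<a))) (acc-segment (rs x<a)) }

≺-irrefl : α ≅ β → ¬ α ≺ β
≺-irrefl e α<β = irrefl (≺-wellFounded _) (≺-respʳ (≅-sym e) α<β)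
  where
  irrefl : ∀ {α} → Acc _≺_ α → ¬ α ≺ α
  irrefl (acc rs) α<α = irrefl (rs α<α) α<α

segment-cancel-< : (α : Ordinal) → let module A = Ordinal α in
                   ∀ {a b} → segment α a ≺ segment α b → a A.< b
segment-cancel-< α {a} {b} lt with Ordinal.compare α a b
... | tri< a<b _ _ = a<b
... | tri≈ _ a≈b _ = contradiction lt (≺-irrefl (segment-≈ α a≈b))
... | tri> _ _ b<a = contradiction (≺-trans lt (segment-< α b<a)) (≺-irrefl ≅-refl)

segment-injective : (α : Ordinal) → let module A = Ordinal α in
                    ∀ {a b} → segment α a ≅ segment α b → a A.≈ b
segment-injective α {a} {b} e with Ordinal.compare α a b
... | tri< a<b _ _ = contradiction (segment-< α a<b) (≺-irrefl e)
... | tri≈ _ a≈b _ = a≈b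
... | tri> _ _ b<a = contradiction (segment-< α b<a) (≺-irrefl (≅-sym e))

-- The isomorphism sends `a` to the bound in `β` of the segment isomorphic to `segment α a`. It is
-- monotone and onto because segments of one ordinal compare as their bounds do.
≅-extensional : (∀ γ → γ ≺ α → γ ≺ β) → (∀ γ → γ ≺ β → γ ≺ α) → α ≅ β
≅-extensional {α} {β} α⊆β β⊆α = mk≅ (λ a → _≺_.bound (hit a))
  (λ {x} {y} x≈y → segment-injective β
    (≅-trans (≅-sym (_≺_.iso (hit x))) (≅-trans (segment-≈ α x≈y) (_≺_.iso (hit y)))))
  (λ {x} {y} x<y → segment-cancel-< β
    (≺-respˡ (_≺_.iso (hit x)) (≺-respʳ (_≺_.iso (hit y)) (segment-< α x<y))))
  (λ b → let below a e = β⊆α _ (segment≺ β b) in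
    a , segment-injective β (≅-sym (≅-trans e (_≺_.iso (hit a)))))
  where
  hit : ∀ a → segment α a ≺ β
  hit a = α⊆β _ (segment≺ α a)

≺-≼-trans : α ≺ β → β ≼ γ → α ≺ γ
≺-≼-trans α<β (inj₁ β<γ) = ≺-trans α<β β<γ
≺-≼-trans α<β (inj₂ e)   = ≺-respʳ e α<β

≼-≺-trans : α ≼ β → β ≺ γ → α ≺ γ
≼-≺-trans (inj₁ α<β) β<γ = ≺-trans α<β β<γ
≼-≺-trans (inj₂ e)   β<γ = ≺-respˡ (≅-sym e) β<γ

≼-trans : α ≼ β → β ≼ γ → α ≼ γ
≼-trans (inj₁ α<β) β≤γ        = inj₁ (≺-≼-trans α<β β≤γ)
≼-trans (inj₂ e)   (inj₁ β<γ) = inj₁ (≺-respˡ (≅-sym e) β<γ)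
≼-trans (inj₂ e)   (inj₂ e′)  = inj₂ (≅-trans e e′)

≺⇒⋡ : α ≺ β → ¬ β ≼ α
≺⇒⋡ α<β β≤α = ≺-irrefl ≅-refl (≺-≼-trans α<β β≤α)

≼-antisym : α ≼ β → β ≼ α → α ≅ β
≼-antisym (inj₁ α<β) β≤α = contradiction β≤α (≺⇒⋡ α<β)
≼-antisym (inj₂ e)   _   = e

≺-sucᵒ : α ≺ sucᵒ α
≺-sucᵒ {α} = below ⊤⁺ (mk≅ (λ a → [ a ] , [ a ]<⊤⁺) [_] [_]
  λ { ([ a ] , _) → a , [ Ordinal.Eq.refl α ] ; (⊤⁺ , ()) })

≺-sucᵒ⁻¹ : α ≺ sucᵒ β → α ≼ β
≺-sucᵒ⁻¹ (below ⊤⁺ e) = inj₂ (≅-trans e (≅-sym (_≺_.iso ≺-sucᵒ)))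
≺-sucᵒ⁻¹ {β = β} (below [ b ] e) = inj₁ (below b (≅-trans e (≅-sym
  (mk≅ (λ (x , x<b) → [ x ] , [ x<b ]) [_] [_]
    λ { ([ x ] , [ x<b ]) → (x , x<b) , [ Ordinal.Eq.refl β ] }))))

sucᵒ-injective : sucᵒ α ≅ sucᵒ β → α ≅ β
sucᵒ-injective e = ≼-antisym
  (≺-sucᵒ⁻¹ (≺-respʳ e ≺-sucᵒ)) (≺-sucᵒ⁻¹ (≺-respʳ (≅-sym e) ≺-sucᵒ))

IsZero-resp : α ≅ β → IsZero α → IsZero β
IsZero-resp e α≡0 = α≡0 ∘ _≅_.from e

IsLimit-resp : α ≅ β → IsLimit α → IsLimit β
IsLimit-resp {β = β} e (α≢0 , α≢suc) =
  α≢0 ∘ IsZero-resp (≅-sym e) , λ (γ , e′) → α≢suc (γ , ≅⇒≈ᵒ (≅-trans e (≈ᵒ⇒≅ β (sucᵒ γ) e′)))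

-- Restrictions of sequences

truncate-id : ∀ {A : Set} (l≤l : l ℕ.≤ l) (xs : Vec A l) → truncate l≤l xs ≡ xs
truncate-id l≤l xs = trans (truncate-irrelevant l≤l ℕ.≤-refl xs) (truncate-refl xs)

truncate-⊕ : (l≤l′ : l ℕ.≤ l′) (x y : Vec Bool l′) →
             truncate l≤l′ (x ⊕ y) ≡ truncate l≤l′ x ⊕ truncate l≤l′ y
truncate-⊕ z≤n        _       _       = refl
truncate-⊕ (s≤s l≤l′) (b ∷ x) (c ∷ y) = cong ((b xor c) ∷_) (truncate-⊕ l≤l′ x y)

truncate-↾ : (l≤l′ : l ℕ.≤ l′) (ρ : ℕ → Bool) → truncate l≤l′ (ρ ↾ l′) ≡ ρ ↾ l
truncate-↾ z≤n        ρ = refl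
truncate-↾ (s≤s l≤l′) ρ = cong (ρ 0 ∷_) (truncate-↾ l≤l′ (ρ ∘ suc))

Prefix⇒truncate : (l≤l′ : l ℕ.≤ l′) {ν : Vec Bool l} {η : Vec Bool l′} →
                  Prefix _≡_ (toList ν) (toList η) → truncate l≤l′ η ≡ ν
Prefix⇒truncate z≤n        {[]}                []         = refl
Prefix⇒truncate (s≤s l≤l′) {_ ∷ _} {_ ∷ _} (refl ∷ p) = cong (_ ∷_) (Prefix⇒truncate l≤l′ p)

truncate⇒Prefix : (l≤l′ : l ℕ.≤ l′) (η : Vec Bool l′) →
                  Prefix _≡_ (toList (truncate l≤l′ η)) (toList η)
truncate⇒Prefix z≤n        η       = []
truncate⇒Prefix (s≤s l≤l′) (_ ∷ η) = refl ∷ truncate⇒Prefix l≤l′ η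

truncate⇒◁ : (l<l′ : l ℕ.< l′) (l≤l′ : l ℕ.≤ l′) (η : Vec Bool l′) →
             toList (truncate l≤l′ η) ◁ toList η
truncate⇒◁ l<l′ l≤l′ η = truncate⇒Prefix l≤l′ η , λ eq → ℕ.<⇒≢ l<l′
  (trans (sym (length-toList (truncate l≤l′ η))) (trans (cong length eq) (length-toList η)))

pair-≡ : ∀ {A : Set} {u : Pred A 0ℓ} {p q : u ⟨2⟩} → fst p ≡ fst q → snd p ≡ snd q → p ≡ q
pair-≡ refl refl = refl

-- The partial order ⊑

-- At a common length truncation is the identity, so `⊑` reduces to agreement of the data. Both
-- tuples are spelled out in order to share the index `l` definitionally.
equal-length⇒⊑ : ∀ {u u′ : Pred (Vec Bool l) 0ℓ} {h : Fin ι → u ⟨2⟩ → ℕ} {g : Fin ι → u ⟨2⟩ → Vec Bool l}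
                 {h′ : Fin ι → u′ ⟨2⟩ → ℕ} {g′ : Fin ι → u′ ⟨2⟩ → Vec Bool l} →
                 u ≐ u′ →
                 (∀ p q → fst p ≡ fst q → snd p ≡ snd q → ∀ i → h i p ≡ h′ i q) →
                 (∀ p q → fst p ≡ fst q → snd p ≡ snd q → ∀ i → g i p ≡ g′ i q) →
                 record { ℓ = l ; u = u ; h = h ; g = g } ⊑
                 record { ℓ = l ; u = u′ ; h = h′ ; g = g′ }
equal-length⇒⊑ {u′ = u′} (u⊆u′ , u′⊆u) h≡ g≡ = record
  { ℓ≤ = ℕ.≤-refl
  ; u≡ = (λ x∈ → _ , u⊆u′ x∈ , truncate-refl _)
       , λ { (x , x∈ , refl) → u′⊆u (subst u′ (sym (truncate-refl x)) x∈) }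
  ; h≡ = λ p q e₁ e₂ → h≡ p q (same e₁) (same e₂)
  ; g≡ = λ p q e₁ e₂ i → trans (g≡ p q (same e₁) (same e₂) i) (sym (truncate-refl _))
  }
  where
  same : ∀ {x y} → truncate ℕ.≤-refl x ≡ y → y ≡ x
  same {x} e = trans (sym e) (truncate-refl x)

≋⇒⊑ : {m n : Tuple ι} → m ≋ n → m ⊑ n
≋⇒⊑ record { ℓ≡ = refl ; u≡ = u⊆ , ⊆u ; h≡ = h≡ ; g≡ = g≡ } = equal-length⇒⊑
  ((λ x∈ → u⊆ (_ , x∈ , cast-is-id refl _)) , λ x∈ → uncast (⊆u x∈))
  (λ p q e₁ e₂ → h≡ p q (trans (cast-is-id refl _) e₁) (trans (cast-is-id refl _) e₂))
  (λ p q e₁ e₂ i → trans (sym (cast-is-id refl _))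
    (g≡ p q (trans (cast-is-id refl _) e₁) (trans (cast-is-id refl _) e₂) i))
  where
  uncast : ∀ {l} {P : Pred (Vec Bool l) 0ℓ} {x} → image (cast refl) P x → x ∈ P
  uncast {P = P} (y , y∈ , refl) = subst P (sym (cast-is-id refl y)) y∈

⊑-refl : {m : Tuple ι} → m ⊑ m
⊑-refl {m = m} = equal-length⇒⊑ (id , id)
  (λ p q e₁ e₂ i → cong (h m i) (pair-≡ e₁ e₂)) (λ p q e₁ e₂ i → cong (g m i) (pair-≡ e₁ e₂))

⊑-trans : {m n o : Tuple ι} → m ⊑ n → n ⊑ o → m ⊑ o
⊑-trans {ι} {m} {n} {o} m⊑n n⊑o = record
  { ℓ≤ = ℓ≤
  ; u≡ = (λ x∈ → let (y , y∈ , y≡) = proj₁ M.u≡ x∈ ; (z , z∈ , z≡) = proj₁ N.u≡ y∈ in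
                 z , z∈ , trans (tt z) (trans (cong (truncate M.ℓ≤) z≡) y≡))
       , λ { (z , z∈ , refl) → proj₂ M.u≡ (_ , proj₂ N.u≡ (z , z∈ , refl) , sym (tt z)) }
  ; h≡ = λ p q e₁ e₂ i → let r = middle p q e₁ e₂ in
           trans (M.h≡ p r (trans (sym (tt _)) e₁) (trans (sym (tt _)) e₂) i) (N.h≡ r q refl refl i)
  ; g≡ = λ p q e₁ e₂ i → let r = middle p q e₁ e₂ in
           trans (M.g≡ p r (trans (sym (tt _)) e₁) (trans (sym (tt _)) e₂) i)
             (trans (cong (truncate M.ℓ≤) (N.g≡ r q refl refl i)) (sym (tt _)))
  }
  where
  module M = _⊑_ m⊑n
  module N = _⊑_ n⊑o

  ℓ≤ : ℓ m ℕ.≤ ℓ o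
  ℓ≤ = ℕ.≤-trans M.ℓ≤ N.ℓ≤

  tt : ∀ (x : Vec Bool (ℓ o)) → truncate ℓ≤ x ≡ truncate M.ℓ≤ (truncate N.ℓ≤ x)
  tt = truncate-trans M.ℓ≤ N.ℓ≤

  -- Sequences that already differ below `ℓ m` also differ below `ℓ n`, so the restrictions to `ℓ n`
  -- form a legitimate pair through which the two hypotheses are composed.
  middle : (p : u m ⟨2⟩) (q : u o ⟨2⟩) →
           truncate ℓ≤ (fst q) ≡ fst p → truncate ℓ≤ (snd q) ≡ snd p → u n ⟨2⟩
  middle (pair _ _ _ _ a≢b) (pair x y x∈ y∈ _) e₁ e₂ =
    pair (truncate N.ℓ≤ x) (truncate N.ℓ≤ y) (proj₂ N.u≡ (x , x∈ , refl)) (proj₂ N.u≡ (y , y∈ , refl))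
      λ eq → a≢b (trans (sym e₁) (trans (tt x) (trans (cong (truncate M.ℓ≤) eq) (trans (sym (tt y)) e₂))))

-- The two hypotheses together make the lengths equal. Truncation is then the identity, and the
-- clauses of `m ⊑ n` become those of `m ≋ n`.
⊑-antisym : {m n : Tuple ι} → m ⊑ n → n ⊑ m → m ≋ n
⊑-antisym {n = n} record { ℓ≤ = ℓ≤ ; u≡ = u⊆ , ⊆u ; h≡ = h≡ ; g≡ = g≡ } n⊑m
  with refl ← ℕ.≤-antisym ℓ≤ (_⊑_.ℓ≤ n⊑m) = record
  { ℓ≡ = refl
  ; u≡ = (λ { (x , x∈ , refl) → subst (u n) (sym (cast-is-id refl x)) (forth (u⊆ x∈)) })
       , λ x∈ → _ , ⊆u (_ , x∈ , truncate-id ℓ≤ _) , cast-is-id refl _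
  ; h≡ = λ p q e₁ e₂ → h≡ p q (same e₁) (same e₂)
  ; g≡ = λ p q e₁ e₂ i → trans (cast-is-id refl _)
           (trans (g≡ p q (same e₁) (same e₂) i) (truncate-id ℓ≤ _))
  }
  where
  same : ∀ {x y} → cast refl x ≡ y → truncate ℓ≤ y ≡ x
  same e = trans (truncate-id ℓ≤ _) (trans (sym e) (cast-is-id refl _))

  forth : ∀ {P x} → image (truncate ℓ≤) P x → P x
  forth {P} (y , y∈ , refl) = subst P (sym (truncate-id ℓ≤ y)) y∈

≋-sym : {m n : Tuple ι} → m ≋ n → n ≋ m
≋-sym {m = m} record { ℓ≡ = refl ; u≡ = u⊆ , ⊆u ; h≡ = h≡ ; g≡ = g≡ } = record
  { ℓ≡ = refl
  ; u≡ = (λ { (x , x∈ , refl) → let (y , y∈ , e) = ⊆u x∈ in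
            subst (u m) (sym (trans (cast-is-id refl x) (trans (sym e) (cast-is-id refl y)))) y∈ })
       , λ x∈ → _ , u⊆ (_ , x∈ , refl) , trans (cast-is-id refl _) (cast-is-id refl _)
  ; h≡ = λ p q e₁ e₂ i → sym (h≡ q p (flip e₁) (flip e₂) i)
  ; g≡ = λ p q e₁ e₂ i → flip (g≡ q p (flip e₁) (flip e₂) i)
  }
  where
  flip : ∀ {l} {x y : Vec Bool l} → cast refl x ≡ y → cast refl y ≡ x
  flip e = trans (cast-is-id refl _) (trans (sym e) (cast-is-id refl _))

⊑-isPartialOrder : IsPartialOrder {A = 𝐌 T ι} (_≋_ on proj₁) (_⊑_ on proj₁)
⊑-isPartialOrder = record
  { isPreorder = record
      { isEquivalence = record
          { refl  = ⊑-antisym ⊑-refl ⊑-refl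
          ; sym   = ≋-sym
          ; trans = λ e e′ → ⊑-antisym (⊑-trans (≋⇒⊑ e) (≋⇒⊑ e′))
                                       (⊑-trans (≋⇒⊑ (≋-sym e′)) (≋⇒⊑ (≋-sym e)))
          }
      ; reflexive = ≋⇒⊑
      ; trans     = ⊑-trans
      }
  ; antisym = ⊑-antisym
  }

-- The rank

Splitting : (m : 𝐌 T ι) → Vec Bool (ℓ (proj₁ m)) → Ordinal → Set₁
Splitting {T} {ι} m ν β = Σ[ n ∈ 𝐌 T ι ]
  ℓ (proj₁ m) ℕ.< ℓ (proj₁ n) × proj₁ m ⊑ proj₁ n × n ndrk≥ β × Splits ν (proj₁ n)

-- In the successor case a node `ν` of `m` is the restriction of some node `η` of `n`. An extension
-- of `n` splitting `η` also extends `m` and splits `ν`, and it keeps its rank.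
ndrk≥-⊑ : (m n : 𝐌 T ι) → proj₁ m ⊑ proj₁ n → n ndrk≥ α → m ndrk≥ α
ndrk≥-⊑ m n m⊑n (zero α≡0)       = zero α≡0
ndrk≥-⊑ m n m⊑n (limit α-lim n≥) = limit α-lim λ β β<α → ndrk≥-⊑ m n m⊑n (n≥ β β<α)
ndrk≥-⊑ m n m⊑n (succ β e split) = succ β e extend
  where
  open _⊑_ m⊑n

  extend : ∀ ν → ν ∈ u (proj₁ m) → Splitting m ν β
  extend ν ν∈ with η , η∈ , refl ← proj₁ u≡ ν∈
    with o , n<o , n⊑o , o≥β , x , y , (x∈ , η◁x) , (y∈ , η◁y) , x≢y ← split η η∈ =
    o , m<o , m⊑o , o≥β , x , y , (x∈ , ν◁ x η◁x) , (y∈ , ν◁ y η◁y) , x≢y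
    where
    m<o = ℕ.≤-<-trans ℓ≤ n<o
    m⊑o = ⊑-trans m⊑n n⊑o

    ν◁ : ∀ x → toList η ◁ toList x → toList (truncate ℓ≤ η) ◁ toList x
    ν◁ x (η≤x , _) = subst (λ ζ → toList ζ ◁ toList x)
      (trans (truncate-trans ℓ≤ (_⊑_.ℓ≤ n⊑o) x)
             (cong (truncate ℓ≤) (Prefix⇒truncate (_⊑_.ℓ≤ n⊑o) η≤x)))
      (truncate⇒◁ m<o (_⊑_.ℓ≤ m⊑o) x)

ndrk≥-≼ : (m : 𝐌 T ι) → β ≼ α → m ndrk≥ α → m ndrk≥ β
ndrk≥-≼ m (inj₁ β<α) (zero α≡0) = contradiction (_≺_.bound β<α) α≡0
ndrk≥-≼ m (inj₂ e)   (zero α≡0) = zero (IsZero-resp (≅-sym e) α≡0)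
ndrk≥-≼ m (inj₁ β<α) (limit α-lim m≥) = m≥ _ (≺⇒<ᵒ β<α)
ndrk≥-≼ {β = β} m (inj₂ e) (limit α-lim m≥) = limit (IsLimit-resp (≅-sym e) α-lim)
  λ γ γ<β → m≥ γ (≺⇒<ᵒ (≺-respʳ e (<ᵒ⇒≺ γ β γ<β)))
ndrk≥-≼ {α = α} m (inj₁ β<α) (succ α′ e split)
  -- Any node will do: splitting it gives an extension of rank at least `α′`, and `β ≼ α′`.
  with ν , _ , ν∈ , _ ← Is𝐌.∣u∣≥2 (proj₂ m)
  with n , _ , m⊑n , n≥α′ , _ ← split ν ν∈ =
  ndrk≥-⊑ m n m⊑n (ndrk≥-≼ n (≺-sucᵒ⁻¹ (≺-respʳ (≈ᵒ⇒≅ α (sucᵒ α′) e) β<α)) n≥α′)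
ndrk≥-≼ {α = α} m (inj₂ e) (succ α′ e′ split) =
  succ α′ (≅⇒≈ᵒ (≅-trans e (≈ᵒ⇒≅ α (sucᵒ α′) e′))) split

ndrk≥-sucᵒ⁻¹ : (m : 𝐌 T ι) → m ndrk≥ sucᵒ α → ∀ ν → ν ∈ u (proj₁ m) → Splitting m ν α
ndrk≥-sucᵒ⁻¹ m (zero α≡0) ν ν∈ = contradiction ⊤⁺ α≡0
ndrk≥-sucᵒ⁻¹ {α = α} m (limit (_ , α≢suc) _) ν ν∈ = contradiction (α , ≈ᵒ-refl (sucᵒ α)) α≢suc
ndrk≥-sucᵒ⁻¹ {α = α} m (succ β e split) ν ν∈
  with n , m<n , m⊑n , n≥β , s ← split ν ν∈ =
  n , m<n , m⊑n , ndrk≥-≼ n (inj₂ (sucᵒ-injective (≈ᵒ⇒≅ (sucᵒ α) (sucᵒ β) e))) n≥β , s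

-- Translations

⊑-+ᴹ : (m n : 𝐌 T ι) (ρ : ℕ → Bool) → proj₁ m ⊑ proj₁ n → proj₁ (m +ᴹ ρ) ⊑ proj₁ (n +ᴹ ρ)
⊑-+ᴹ (m , _) (n , _) ρ m⊑n = record
  { ℓ≤ = ℓ≤
  ; u≡ = (λ { (x , x∈ , refl) → let (y , y∈ , e) = proj₁ u≡ x∈ in
            y ⊕ ρₙ , (y , y∈ , refl) , trans (shift y) (cong (_⊕ ρₘ) e) })
       , λ { (_ , (y , y∈ , refl) , refl) →
            truncate ℓ≤ y , proj₂ u≡ (y , y∈ , refl) , sym (shift y) }
  ; h≡ = λ p q e₁ e₂ → h≡ _ _ (trans (shift _) (cong (_⊕ ρₘ) e₁)) (trans (shift _) (cong (_⊕ ρₘ) e₂))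
  ; g≡ = λ p q e₁ e₂ → g≡ _ _ (trans (shift _) (cong (_⊕ ρₘ) e₁)) (trans (shift _) (cong (_⊕ ρₘ) e₂))
  }
  where
  open _⊑_ m⊑n
  ρₘ = ρ ↾ ℓ m
  ρₙ = ρ ↾ ℓ n

  shift : ∀ y → truncate ℓ≤ (y ⊕ ρₙ) ≡ truncate ℓ≤ y ⊕ ρₘ
  shift y = trans (truncate-⊕ ℓ≤ y ρₙ) (cong (truncate ℓ≤ y ⊕_) (truncate-↾ ℓ≤ ρ))

-- The witnessing extensions are translated too. They are longer than `m`, so they consume further
-- bits of `ρ`; this is why `ρ` is an infinite sequence.
ndrk≥-+ᴹ : (m : 𝐌 T ι) (ρ : ℕ → Bool) → m ndrk≥ α → (m +ᴹ ρ) ndrk≥ α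
ndrk≥-+ᴹ m ρ (zero α≡0)       = zero α≡0
ndrk≥-+ᴹ m ρ (limit α-lim m≥) = limit α-lim λ β β<α → ndrk≥-+ᴹ m ρ (m≥ β β<α)
ndrk≥-+ᴹ m ρ (succ β e split) = succ β e extend
  where
  extend : ∀ ν → ν ∈ u (proj₁ (m +ᴹ ρ)) → Splitting (m +ᴹ ρ) ν β
  extend _ (ν , ν∈ , refl)
    with n , m<n , m⊑n , n≥β , x , y , (x∈ , ν◁x , _) , (y∈ , ν◁y , _) , x≢y ← split ν ν∈ =
    n +ᴹ ρ , m<n , m+⊑n+ , ndrk≥-+ᴹ n ρ n≥β ,
    x ⊕ ρₙ , y ⊕ ρₙ , ((x , x∈ , refl) , ν+◁ x ν◁x) , ((y , y∈ , refl) , ν+◁ y ν◁y) ,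
    x≢y ∘ ⊕-injectiveˡ ρₙ
    where
    m+⊑n+ = ⊑-+ᴹ m n ρ m⊑n
    open _⊑_ m⊑n using (ℓ≤)
    ρₘ = ρ ↾ ℓ (proj₁ m)
    ρₙ = ρ ↾ ℓ (proj₁ n)

    ν+◁ : ∀ x → Prefix _≡_ (toList ν) (toList x) → toList (ν ⊕ ρₘ) ◁ toList (x ⊕ ρₙ)
    ν+◁ x ν≤x = subst (λ ζ → toList ζ ◁ toList (x ⊕ ρₙ))
      (trans (truncate-⊕ ℓ≤ x ρₙ) (cong₂ _⊕_ (Prefix⇒truncate ℓ≤ ν≤x) (truncate-↾ ℓ≤ ρ)))
      (truncate⇒◁ m<n ℓ≤ (x ⊕ ρₙ))

-- Addition of `ρ` is an involution on sequences. Translating back in this way gives the converse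
-- inequality between the ranks of `m` and `m +ᴹ ρ`.
⊑-+ᴹ-+ᴹ : (m : 𝐌 T ι) (ρ : ℕ → Bool) → proj₁ m ⊑ proj₁ (m +ᴹ ρ +ᴹ ρ)
⊑-+ᴹ-+ᴹ (m , _) ρ = equal-length⇒⊑
  ( (λ {x} x∈ → x ⊕ r , (x , x∈ , refl) , ⊕-cancelʳ x r)
  , λ { (_ , (x , x∈ , refl) , refl) → subst (u m) (sym (⊕-cancelʳ x r)) x∈ })
  (λ p q e₁ e₂ i → cong (h m i) (pair-≡ (trans e₁ (sym (⊕-cancelʳ _ r))) (trans e₂ (sym (⊕-cancelʳ _ r)))))
  (λ p q e₁ e₂ i → cong (g m i) (pair-≡ (trans e₁ (sym (⊕-cancelʳ _ r))) (trans e₂ (sym (⊕-cancelʳ _ r)))))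
  where r = ρ ↾ ℓ m

-- Restriction to a subset of the nodes

restrict-Is𝐌 : (m : 𝐌 T ι) (u′ : Pred (Vec Bool (ℓ (proj₁ m))) 0ℓ) (u′⊆u : u′ ⊆ u (proj₁ m)) →
               AtLeastTwo u′ → Is𝐌 T ι (restrict (proj₁ m) u′ u′⊆u)
restrict-Is𝐌 (m , m∈) u′ u′⊆u ∣u′∣≥2 = record
  { ℓ>0   = ℓ>0
  ; ∣u∣≥2 = ∣u′∣≥2
  ; g∈T   = λ i p → g∈T i _
  ; sums  = λ i p → sums i _
  ; norep = λ p → norep _
  }
  where open Is𝐌 m∈

-- Each witnessing extension is cut down to its nodes lying above `u′`. The two nodes above `ν`
-- survive, which preserves the splitting and also leaves at least two nodes.
ndrk≥-restrict : (m : 𝐌 T ι) (u′ : Pred (Vec Bool (ℓ (proj₁ m))) 0ℓ) (u′⊆u : u′ ⊆ u (proj₁ m))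
                 (∣u′∣≥2 : AtLeastTwo u′) →
                 m ndrk≥ α → (restrict (proj₁ m) u′ u′⊆u , restrict-Is𝐌 m u′ u′⊆u ∣u′∣≥2) ndrk≥ α
ndrk≥-restrict m u′ u′⊆u ∣u′∣≥2 (zero α≡0)       = zero α≡0
ndrk≥-restrict m u′ u′⊆u ∣u′∣≥2 (limit α-lim m≥) =
  limit α-lim λ β β<α → ndrk≥-restrict m u′ u′⊆u ∣u′∣≥2 (m≥ β β<α)
ndrk≥-restrict m u′ u′⊆u ∣u′∣≥2 (succ β e split) = succ β e extend
  where
  extend : ∀ ν → ν ∈ u′ →
           Splitting (restrict (proj₁ m) u′ u′⊆u , restrict-Is𝐌 m u′ u′⊆u ∣u′∣≥2) ν β
  extend ν ν∈
    with n , m<n , m⊑n , n≥β , x , y , (x∈ , ν◁x) , (y∈ , ν◁y) , x≢y ← split ν (u′⊆u ν∈) =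
    (restrict (proj₁ n) u″ proj₁ , _) , m<n , m′⊑n′ , ndrk≥-restrict n u″ proj₁ ∣u″∣≥2 n≥β ,
    x , y , (over x x∈ ν◁x , ν◁x) , (over y y∈ ν◁y , ν◁y) , x≢y
    where
    open _⊑_ m⊑n
    u″ : Pred (Vec Bool (ℓ (proj₁ n))) 0ℓ
    u″ η = η ∈ u (proj₁ n) × truncate ℓ≤ η ∈ u′

    over : ∀ x → x ∈ u (proj₁ n) → toList ν ◁ toList x → x ∈ u″
    over x x∈ (ν≤x , _) = x∈ , subst u′ (sym (Prefix⇒truncate ℓ≤ ν≤x)) ν∈

    ∣u″∣≥2 : AtLeastTwo u″
    ∣u″∣≥2 = x , y , over x x∈ ν◁x , over y y∈ ν◁y , x≢y

    m′⊑n′ : restrict (proj₁ m) u′ u′⊆u ⊑ restrict (proj₁ n) u″ proj₁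
    m′⊑n′ = record
      { ℓ≤ = ℓ≤
      ; u≡ = (λ a∈ → let (b , b∈ , e) = proj₁ u≡ (u′⊆u a∈) in
                b , (b∈ , subst u′ (sym e) a∈) , e)
           , λ { (b , (b∈ , a∈) , refl) → a∈ }
      ; h≡ = λ p q → h≡ _ _
      ; g≡ = λ p q → g≡ _ _
      }

-- Countability

-- ⟪ a , b ⟫ = 2ᵃ (2 b + 1)
⟪_,_⟫ : ℕ → ℕ → ℕ
⟪ zero  , b ⟫ = suc (2 ℕ.* b)
⟪ suc a , b ⟫ = 2 ℕ.* ⟪ a , b ⟫

⟪,⟫-injective : ∀ a b {c d} → ⟪ a , b ⟫ ≡ ⟪ c , d ⟫ → a ≡ c × b ≡ d
⟪,⟫-injective zero    b {zero}  eq = refl , ℕ.*-cancelˡ-≡ _ _ 2 (ℕ.suc-injective eq)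
⟪,⟫-injective zero    b {suc c} {d} eq = contradiction (sym eq) (ℕ.even≢odd ⟪ c , d ⟫ b)
⟪,⟫-injective (suc a) b {zero}  {d} eq = contradiction eq (ℕ.even≢odd ⟪ a , b ⟫ d)
⟪,⟫-injective (suc a) b {suc c} eq with refl , eq′ ← ⟪,⟫-injective a b {c} (ℕ.*-cancelˡ-≡ _ _ 2 eq) = refl , eq′

encodeFin : ∀ n → (Fin n → ℕ) → ℕ
encodeFin zero    f = 0
encodeFin (suc n) f = ⟪ f zero , encodeFin n (f ∘ suc) ⟫

encodeFin-injective : ∀ n (f f′ : Fin n → ℕ) → encodeFin n f ≡ encodeFin n f′ → ∀ i → f i ≡ f′ i
encodeFin-injective (suc n) f f′ eq i
  with ⟪,⟫-injective (f zero) (encodeFin n (f ∘ suc)) {f′ zero} eq | i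
... | eq₀ , _   | zero  = eq₀
... | _   , eq₊ | suc i = encodeFin-injective n (f ∘ suc) (f′ ∘ suc) eq₊ i

-- The function is read as a binary tree of depth `l` with its values at the leaves.
encodeCube : ∀ l → (Vec Bool l → ℕ) → ℕ
encodeCube zero    f = f []
encodeCube (suc l) f = ⟪ encodeCube l (f ∘ (false ∷_)) , encodeCube l (f ∘ (true ∷_)) ⟫

encodeCube-injective : ∀ l (f f′ : Vec Bool l → ℕ) → encodeCube l f ≡ encodeCube l f′ → ∀ x → f x ≡ f′ x
encodeCube-injective zero    f f′ eq []      = eq
encodeCube-injective (suc l) f f′ eq (b ∷ x)
  with ⟪,⟫-injective (encodeCube l (f ∘ (false ∷_))) _ {encodeCube l (f′ ∘ (false ∷_))} eq | b
... | eq₀ , _   | false = encodeCube-injective l (f ∘ (false ∷_)) (f′ ∘ (false ∷_)) eq₀ x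
... | _   , eq₁ | true  = encodeCube-injective l (f ∘ (true ∷_)) (f′ ∘ (true ∷_)) eq₁ x

encodeVec : Vec Bool l → ℕ
encodeVec []      = 0
encodeVec (b ∷ x) = ⟪ (if b then 1 else 0) , encodeVec x ⟫

encodeVec-injective : (x y : Vec Bool l) → encodeVec x ≡ encodeVec y → x ≡ y
encodeVec-injective []          []          eq = refl
encodeVec-injective (false ∷ x) (false ∷ y) eq =
  cong (false ∷_) (encodeVec-injective x y (proj₂ (⟪,⟫-injective 0 (encodeVec x) {0} eq)))
encodeVec-injective (true ∷ x)  (true ∷ y)  eq =
  cong (true ∷_) (encodeVec-injective x y (proj₂ (⟪,⟫-injective 1 (encodeVec x) {1} eq)))
encodeVec-injective (false ∷ x) (true ∷ y)  eq
  with () ← proj₁ (⟪,⟫-injective 0 (encodeVec x) {1} {encodeVec y} eq)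
encodeVec-injective (true ∷ x)  (false ∷ y) eq
  with () ← proj₁ (⟪,⟫-injective 1 (encodeVec x) {0} {encodeVec y} eq)

Countable-resp : α ≅ β → Countable α → Countable β
Countable-resp {α} {β} e c = record
  { to        = C.to ∘ E.to
  ; cong      = C.cong ∘ E.to-cong
  ; injective = E.injective ∘ C.injective
  }
  where
  module C = Injection c
  module E = _≅_ (≅-sym e)

Countable-sucᵒ : ∀ α → Countable α → Countable (sucᵒ α)
Countable-sucᵒ α c = record
  { to        = to⁺
  ; cong      = λ { [ x≈y ] → cong suc (C.cong x≈y) ; ⊤⁺≈⊤⁺ → refl }
  ; injective = λ {x} {y} → injective⁺ x y
  }
  where
  module C = Injection c

  to⁺ : Ordinal.Carrier (sucᵒ α) → ℕ
  to⁺ [ x ] = suc (C.to x)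
  to⁺ ⊤⁺    = 0

  injective⁺ : ∀ x y → to⁺ x ≡ to⁺ y → Ordinal._≈_ (sucᵒ α) x y
  injective⁺ [ x ] [ y ] eq = [ C.injective (ℕ.suc-injective eq) ]
  injective⁺ ⊤⁺    ⊤⁺    eq = ⊤⁺≈⊤⁺

-- Consequences of excluded middle

module Classical (em : ExcludedMiddle (lsuc 0ℓ)) where

  em₀ : ExcludedMiddle 0ℓ
  em₀ = map′ lower lift em

  -- If neither ordinal is dominated by a predecessor of the other, the induction hypothesis shows
  -- that both have the same predecessors, and extensionality makes them isomorphic.
  ≼-≺-connex : ∀ α β → α ≼ β ⊎ β ≺ α
  ≼-≺-connex α β = go (≺-wellFounded α) (≺-wellFounded β)
    where
    go : ∀ {α β} → Acc _≺_ α → Acc _≺_ β → α ≼ β ⊎ β ≺ α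
    go {α} {β} (acc rs) (acc ss)
      with em {Σ[ γ ∈ Ordinal ] γ ≺ α × β ≼ γ} | em {Σ[ δ ∈ Ordinal ] δ ≺ β × α ≼ δ}
    ... | yes (γ , γ<α , β≤γ) | _ = inj₂ (≼-≺-trans β≤γ γ<α)
    ... | no _  | yes (δ , δ<β , α≤δ) = inj₁ (inj₁ (≼-≺-trans α≤δ δ<β))
    ... | no ¬γ | no ¬δ = inj₁ (inj₂ (≅-extensional below-α below-β))
      where
      below-α : ∀ γ → γ ≺ α → γ ≺ β
      below-α γ γ<α with go (rs γ<α) (acc ss)
      ... | inj₁ (inj₁ γ<β) = γ<β
      ... | inj₁ (inj₂ e)   = contradiction (γ , γ<α , inj₂ (≅-sym e)) ¬γ
      ... | inj₂ β<γ        = contradiction (γ , γ<α , inj₁ β<γ) ¬γ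

      below-β : ∀ δ → δ ≺ β → δ ≺ α
      below-β δ δ<β with go (acc rs) (ss δ<β)
      ... | inj₁ α≤δ = contradiction (δ , δ<β , α≤δ) ¬δ
      ... | inj₂ δ<α = δ<α

  ⋠⇒≻ : ¬ α ≼ β → β ≺ α
  ⋠⇒≻ {α} {β} α⋠β with ≼-≺-connex α β
  ... | inj₁ α≤β = contradiction α≤β α⋠β
  ... | inj₂ β<α = β<α

  sucᵒ-least : α ≺ β → sucᵒ α ≼ β
  sucᵒ-least {α} {β} α<β with ≼-≺-connex (sucᵒ α) β
  ... | inj₁ le = le
  ... | inj₂ β<sα = contradiction (≺-sucᵒ⁻¹ β<sα) (≺⇒⋡ α<β)

  -- The least failing `α` is not zero, and not a limit either, since all smaller bounds hold. So it
  -- is a successor, and its predecessor is the rank.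
  ndrk-exists : (m : 𝐌 T ι) → Σ ON∞ (IsNdrk m)
  ndrk-exists {T} {ι} m with em {Σ[ α ∈ Ordinal ] ¬ m ndrk≥ α}
  ... | no ¬α = ⊤⁺ , λ α → em⇒dne em (λ m≱α → ¬α (α , m≱α))
  ... | yes (α , m≱α) = go (≺-wellFounded α) m≱α
    where
    go : ∀ {α} → Acc _≺_ α → ¬ m ndrk≥ α → Σ ON∞ (IsNdrk m)
    go {α} (acc rs) m≱α with em {Σ[ β ∈ Ordinal ] β ≺ α × ¬ m ndrk≥ β}
    ... | yes (β , β<α , m≱β) = go (rs β<α) m≱β
    ... | no minimal with em₀ {IsZero α} | em {Σ[ β ∈ Ordinal ] α ≈ᵒ sucᵒ β}
    ...   | yes α≡0 | _ = contradiction (zero α≡0) m≱α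
    ...   | no α≢0 | no α≢suc = contradiction (limit (α≢0 , α≢suc) λ β β<α →
              em⇒dne em λ m≱β → minimal (β , <ᵒ⇒≺ β α β<α , m≱β)) m≱α
    ...   | no α≢0 | yes (β , e) = [ β ] ,
              (em⇒dne em λ m≱β → minimal (β , β<α , m≱β)) ,
              λ γ m≥γ → ≼⇒≤ᵒ (≺-sucᵒ⁻¹ (≺-respʳ α≅ (⋠⇒≻ λ α≼γ → m≱α (ndrk≥-≼ m α≼γ m≥γ))))
      where
      α≅ = ≈ᵒ⇒≅ α (sucᵒ β) e
      β<α = ≺-respʳ (≅-sym α≅) ≺-sucᵒ

  ndrk-isNdrk : (m : 𝐌 T ι) → IsNdrk m (ndrk em m)
  ndrk-isNdrk m with em {Σ ON∞ (IsNdrk m)}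
  ... | yes (_ , v) = v
  ... | no ¬v       = contradiction (ndrk-exists m) ¬v

  IsNdrk-mono : (m n : 𝐌 T ι) {v w : ON∞} → (∀ α → m ndrk≥ α → n ndrk≥ α) →
                IsNdrk m v → IsNdrk n w → v ≤⁺ w
  IsNdrk-mono m n {w = ⊤⁺} m⇒n _ _ = _ ≤⊤⁺
  IsNdrk-mono m n {[ α ]} {[ β ]} m⇒n (m≥α , _) (_ , n≤β) = [ n≤β α (m⇒n α m≥α) ]
  IsNdrk-mono m n {⊤⁺}    {[ β ]} m⇒n m≥ (_ , n≤β) = contradiction
    (≤ᵒ⇒≼ (sucᵒ β) β (n≤β (sucᵒ β) (m⇒n (sucᵒ β) (m≥ (sucᵒ β))))) (≺⇒⋡ ≺-sucᵒ)

  ≤⁺-antisym : {v w : ON∞} → v ≤⁺ w → w ≤⁺ v → v ≈⁺ w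
  ≤⁺-antisym {[ α ]} {[ β ]} [ α≤β ] [ β≤α ] =
    [ ≅⇒≈ᵒ (≼-antisym (≤ᵒ⇒≼ α β α≤β) (≤ᵒ⇒≼ β α β≤α)) ]
  ≤⁺-antisym (_ ≤⊤⁺) (_ ≤⊤⁺) = ⊤⁺≈⊤⁺

  IsNdrk-unique : (m : 𝐌 T ι) {v w : ON∞} → IsNdrk m v → IsNdrk m w → v ≈⁺ w
  IsNdrk-unique m v w = ≤⁺-antisym (IsNdrk-mono m m (λ _ → id) v w) (IsNdrk-mono m m (λ _ → id) w v)

  ndrk-mono : (m n : 𝐌 T ι) → (∀ α → m ndrk≥ α → n ndrk≥ α) → ndrk em m ≤⁺ ndrk em n
  ndrk-mono m n m⇒n = IsNdrk-mono m n m⇒n (ndrk-isNdrk m) (ndrk-isNdrk n)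

  ≤ndrk⇒ndrk≥ : (m : 𝐌 T ι) → [ α ] ≤⁺ ndrk em m → m ndrk≥ α
  ≤ndrk⇒ndrk≥ {α = α} m = go (ndrk-isNdrk m)
    where
    go : ∀ {v} → IsNdrk m v → [ α ] ≤⁺ v → m ndrk≥ α
    go {[ β ]} (m≥β , _) [ α≤β ] = ndrk≥-≼ m (≤ᵒ⇒≼ α β α≤β) m≥β
    go {⊤⁺}    m≥        _       = m≥ α

  ndrk≥⇒≤ndrk : (m : 𝐌 T ι) → m ndrk≥ α → [ α ] ≤⁺ ndrk em m
  ndrk≥⇒≤ndrk {α = α} m m≥α = go (ndrk-isNdrk m)
    where
    go : ∀ {v} → IsNdrk m v → [ α ] ≤⁺ v
    go {[ β ]} (_ , m≤β) = [ m≤β α m≥α ]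
    go {⊤⁺}    _         = _ ≤⊤⁺

  -- A non-minimal rank γ ≽ α among the extensions of m can be lowered: at a node ν
  -- witnessing that ndrk m ≱ γ + 1, any extension given by ndrk m ≥ α + 1 has rank < γ.
  descend : (m : 𝐌 T ι) → Acc _≺_ γ → IsNdrk m [ γ ] → α ≼ γ →
            Σ[ n ∈ 𝐌 T ι ] proj₁ m ⊑ proj₁ n × IsNdrk n [ α ]
  descend {γ = γ} {α = α} m _ (m≥γ , m≤γ) (inj₂ e) =
    m , ⊑-refl , ndrk≥-≼ m (inj₂ e) m≥γ ,
    λ β m≥β → ≼⇒≤ᵒ (≼-trans (≤ᵒ⇒≼ β γ (m≤γ β m≥β)) (inj₂ (≅-sym e)))
  descend {γ = γ} {α = α} m (acc rs) (m≥γ , m≤γ) (inj₁ α<γ)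
    with em {Σ[ ν ∈ _ ] ν ∈ u (proj₁ m) × ¬ Splitting m ν γ}
  ... | no ¬ν = contradiction
    (≤ᵒ⇒≼ (sucᵒ γ) γ (m≤γ (sucᵒ γ) (succ γ (≈ᵒ-refl (sucᵒ γ)) λ ν ν∈ →
      em⇒dne em λ ¬s → ¬ν (ν , ν∈ , ¬s))))
    (≺⇒⋡ ≺-sucᵒ)
  ... | yes (ν , ν∈ , ¬s)
    with n , m<n , m⊑n , n≥α , s ← ndrk≥-sucᵒ⁻¹ m (ndrk≥-≼ m (sucᵒ-least α<γ) m≥γ) ν ν∈
    with ndrk-exists n
  ...   | ⊤⁺ , n≥ = contradiction (n , m<n , m⊑n , n≥ γ , s) ¬s
  ...   | [ δ ] , n≥δ , n≤δ =
    let (o , n⊑o , o-rk) = descend n (rs δ<γ) (n≥δ , n≤δ) (≤ᵒ⇒≼ α δ (n≤δ α n≥α))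
    in o , ⊑-trans m⊑n n⊑o , o-rk
    where
    δ<γ = ⋠⇒≻ λ γ≼δ → ¬s (n , m<n , m⊑n , ndrk≥-≼ n γ≼δ n≥δ , s)

  smaller-ndrk : (m : 𝐌 T ι) (α β : Ordinal) → ndrk em m ≈⁺ [ β ] → α <ᵒ β →
                 Σ[ n ∈ 𝐌 T ι ] proj₁ m ⊑ proj₁ n × ndrk em n ≈⁺ [ α ]
  smaller-ndrk {T} {ι} m α β = go (ndrk-isNdrk m)
    where
    go : ∀ {v} → IsNdrk m v → v ≈⁺ [ β ] → α <ᵒ β →
         Σ[ n ∈ 𝐌 T ι ] proj₁ m ⊑ proj₁ n × ndrk em n ≈⁺ [ α ]
    go {[ γ ]} m-rk [ e ] α<β
      with n , m⊑n , n-rk ← descend m (≺-wellFounded γ) m-rk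
             (inj₁ (≺-respʳ (≅-sym (≈ᵒ⇒≅ γ β e)) (<ᵒ⇒≺ α β α<β))) =
      n , m⊑n , IsNdrk-unique n (ndrk-isNdrk n) n-rk

  -- Coding tuples by natural numbers

  least : {P : Pred ℕ 0ℓ} → ∃ P → ∃[ k ] P k × (∀ j → P j → k ℕ.≤ j)
  least {P} (k , pk) = go (<-wellFounded k) pk
    where
    go : ∀ {k} → Acc ℕ._<_ k → P k → ∃[ k ] P k × (∀ j → P j → k ℕ.≤ j)
    go {k} (acc rs) pk with em₀ {∃[ j ] j ℕ.< k × P j}
    ... | yes (j , j<k , pj) = go (rs j<k) pj
    ... | no ¬j = k , pk , λ j pj → ℕ.≮⇒≥ λ j<k → ¬j (j , j<k , pj)

  -- An element may carry many codes. The least one is a canonical choice, so equal elements receive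
  -- the same number.
  relation⇒Countable : (α : Ordinal) (S : Ordinal.Carrier α → Pred ℕ 0ℓ) → (∀ a → ∃ (S a)) →
                       (∀ {a b c} → Ordinal._≈_ α a b → S a c → S b c) →
                       (∀ {a b c} → S a c → S b c → Ordinal._≈_ α a b) → Countable α
  relation⇒Countable α S total resp unique = record
    { to        = λ a → proj₁ (first a)
    ; cong      = λ {a} {b} a≈b → let (j , Saj , j≤) = first a ; (k , Sbk , k≤) = first b in
        ℕ.≤-antisym (j≤ k (resp (Ordinal.Eq.sym α a≈b) Sbk)) (k≤ j (resp a≈b Saj))
    ; injective = λ {a} {b} eq → unique (subst (S a) eq (proj₁ (proj₂ (first a)))) (proj₁ (proj₂ (first b)))
    }
    where
    first : ∀ a → ∃[ k ] S a k × (∀ j → S a j → k ℕ.≤ j)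
    first a = least (total a)

  flag : (P : Set) → ℕ
  flag P with em₀ {P}
  ... | yes _ = 1
  ... | no  _ = 0

  flag-≡ : {P Q : Set} → flag P ≡ flag Q → P → Q
  flag-≡ {P} {Q} eq p with em₀ {P} | em₀ {Q}
  ... | _     | yes q = q
  ... | no ¬p | no _  = contradiction p ¬p

  module _ {A : Set} {u : Pred A 0ℓ} (f : u ⟨2⟩ → ℕ) where

    extendByZero : A → A → ℕ
    extendByZero x y with em₀ {x ∈ u × y ∈ u × x ≢ y}
    ... | yes (x∈ , y∈ , x≢y) = f (pair x y x∈ y∈ x≢y)
    ... | no  _               = 0

    -- The proofs stored in a pair are irrelevant, so the value at the proofs found by `em₀` is
    -- `f p` by definition.
    extendByZero-≡ : (p : u ⟨2⟩) → extendByZero (fst p) (snd p) ≡ f p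
    extendByZero-≡ (pair x y x∈ y∈ x≢y) with em₀ {x ∈ u × y ∈ u × x ≢ y}
    ... | yes _ = refl
    ... | no ¬p = contradiction-irr (x∈ , y∈ , x≢y) ¬p

  encodePairs : ∀ {u : Pred (Vec Bool l) 0ℓ} → (Fin ι → u ⟨2⟩ → ℕ) → ℕ
  encodePairs {l} {ι} f = encodeFin ι λ i → encodeCube l λ x → encodeCube l λ y → extendByZero (f i) x y

  encodePairs-injective : ∀ {u u′ : Pred (Vec Bool l) 0ℓ} (f : Fin ι → u ⟨2⟩ → ℕ) (f′ : Fin ι → u′ ⟨2⟩ → ℕ) →
                     encodePairs f ≡ encodePairs f′ →
                     ∀ p q → fst p ≡ fst q → snd p ≡ snd q → ∀ i → f i p ≡ f′ i q
  encodePairs-injective {l} {ι} f f′ eq p q refl refl i = trans (sym (extendByZero-≡ (f i) p)) (trans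
    (encodeCube-injective l (extendByZero (f i) (fst p)) (extendByZero (f′ i) (fst p))
      (encodeCube-injective l (table f i) (table f′ i)
        (encodeFin-injective ι (encodeCube l ∘ table f) (encodeCube l ∘ table f′) eq i) (fst p)) (snd p))
    (extendByZero-≡ (f′ i) q))
    where
    table : ∀ {u} → (Fin ι → u ⟨2⟩ → ℕ) → Fin ι → Vec Bool l → ℕ
    table f i x = encodeCube l (extendByZero (f i) x)

  code : Tuple ι → ℕ
  code m = ⟪ ℓ m , ⟪ encodeCube (ℓ m) (λ x → flag (x ∈ u m)) ,
           ⟪ encodePairs (h m) , encodePairs (λ i → encodeVec ∘ g m i) ⟫ ⟫ ⟫

  -- The length is decoded first, so that the remaining components are tables over the same cube.
  -- The default `0` does no harm because tables are compared only at genuine pairs.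
  code-⊑ : (m n : Tuple ι) → code m ≡ code n → m ⊑ n
  code-⊑ m@record { ℓ = l } n eq with ⟪,⟫-injective l _ {ℓ n} eq
  ... | refl , eq′
    with u-eq , eq″ ← ⟪,⟫-injective (encodeCube l (λ x → flag (x ∈ u m))) _ {encodeCube l (λ x → flag (x ∈ u n))} eq′
    with h-eq , g-eq ← ⟪,⟫-injective (encodePairs (h m)) _ {encodePairs (h n)} eq″ = equal-length⇒⊑
    ( (λ {x} → flag-≡ (encodeCube-injective l _ (λ x → flag (x ∈ u n)) u-eq x))
    , (λ {x} → flag-≡ (sym (encodeCube-injective l _ (λ x → flag (x ∈ u n)) u-eq x))))
    (encodePairs-injective (h m) (h n) h-eq)
    (λ p q e₁ e₂ i → encodeVec-injective _ _
      (encodePairs-injective (λ i → encodeVec ∘ g m i) (λ i → encodeVec ∘ g n i) g-eq p q e₁ e₂ i))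

  -- Ranks and the first uncountable ordinal

  module FirstUncountable (ω₁ : Ordinal) (ω₁-first : IsFirstUncountable ω₁) where
    private module Ω = Ordinal ω₁

    ω₁-uncountable : ¬ Countable ω₁
    ω₁-uncountable = proj₁ ω₁-first

    segment-countable : ∀ a → Countable (segment ω₁ a)
    segment-countable a = proj₂ ω₁-first (segment ω₁ a) (≺⇒<ᵒ (segment≺ ω₁ a))

    ω₁-nonZero : ¬ IsZero ω₁
    ω₁-nonZero ω₁≡0 = ω₁-uncountable record
      { to = ⊥-elim ∘ ω₁≡0 ; cong = λ {x} → ⊥-elim (ω₁≡0 x) ; injective = λ {x} → ⊥-elim (ω₁≡0 x) }

    ω₁-limit : IsLimit ω₁
    ω₁-limit = ω₁-nonZero , λ (β , e) → let e′ = ≈ᵒ⇒≅ ω₁ (sucᵒ β) e in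
      ω₁-uncountable (Countable-resp (≅-sym e′) (Countable-sucᵒ β
        (proj₂ ω₁-first β (≺⇒<ᵒ (≺-respʳ (≅-sym e′) ≺-sucᵒ)))))

    -- Otherwise `ω₁` would be the union of the countable sets of elements up to `F k`, and the pair
    -- of `k` with an index in the k-th set would code each element. The injections for all `k` come
    -- together from `ω₁-first`.
    ω₁-regular : (F : ℕ → Ω.Carrier) → ∃[ b ] ∀ k → F k Ω.< b
    ω₁-regular F = em⇒dne em₀ λ unbounded → ω₁-uncountable (relation⇒Countable ω₁ S
      (λ b → total b (em⇒dne em₀ λ ¬k → unbounded (b , λ k → em⇒dne em₀ λ Fk≮b → ¬k (k , Fk≮b))))
      (λ { b≈b′ (k , x , eq , x≈b) → k , x , eq , Ω.Eq.trans x≈b b≈b′ })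
      unique)
      where
      -- The added top element stands for `F k` itself: an element not above `F k` may be equal to
      -- it.
      Below : ℕ → Ordinal
      Below k = sucᵒ (segment ω₁ (F k))

      index : ∀ k → Countable (Below k)
      index k = Countable-sucᵒ (segment ω₁ (F k)) (segment-countable (F k))

      value : ∀ k → Ordinal.Carrier (Below k) → Ω.Carrier
      value k [ x , _ ] = x
      value k ⊤⁺        = F k

      value-cong : ∀ k {x y} → Ordinal._≈_ (Below k) x y → value k x Ω.≈ value k y
      value-cong k [ x≈y ] = x≈y
      value-cong k ⊤⁺≈⊤⁺   = Ω.Eq.refl

      S : Ω.Carrier → Pred ℕ 0ℓ
      S b c = ∃[ k ] ∃[ x ] c ≡ ⟪ k , Injection.to (index k) x ⟫ × value k x Ω.≈ b

      total : ∀ b → ∃[ k ] ¬ F k Ω.< b → ∃ (S b)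
      total b (k , Fk≮b) with Ω.compare b (F k)
      ... | tri< b<Fk _ _ = _ , k , [ b , b<Fk ] , refl , Ω.Eq.refl
      ... | tri≈ _ b≈Fk _ = _ , k , ⊤⁺ , refl , Ω.Eq.sym b≈Fk
      ... | tri> _ _ Fk<b = contradiction Fk<b Fk≮b

      unique : ∀ {a b c} → S a c → S b c → a Ω.≈ b
      unique (k , x , refl , x≈a) (j , y , eq , y≈b)
        with refl , eq′ ← ⟪,⟫-injective k _ {j} eq =
        Ω.Eq.trans (Ω.Eq.sym x≈a) (Ω.Eq.trans (value-cong k (Injection.injective (index k) eq′)) y≈b)

    -- Tuples with the same code satisfy the same rank bounds, so one failing segment serves a whole
    -- code. It exists, since otherwise the limit clause would give rank at least `ω₁`. Regularity
    -- then bounds these countably many segments.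
    bounded-ndrk : (X : 𝐌 T ι → Set₁) → (∀ n → X n → ¬ n ndrk≥ ω₁) →
                   ∃[ b ] ∀ n → X n → ¬ n ndrk≥ segment ω₁ b
    bounded-ndrk {T} {ι} X X≱ω₁ =
      let (b , F<b) = ω₁-regular (λ k → proj₁ (bound k)) in
      b , λ n n∈X n≥b → proj₂ (bound (code (proj₁ n))) n n∈X refl
            (ndrk≥-≼ n (inj₁ (segment-< ω₁ (F<b (code (proj₁ n))))) n≥b)
      where
      bound : ∀ k → ∃[ a ] ∀ n → X n → code (proj₁ n) ≡ k → ¬ n ndrk≥ segment ω₁ a
      bound k with em {Σ[ n ∈ 𝐌 T ι ] X n × code (proj₁ n) ≡ k}
      -- No member of `X` has code `k`, so any element of `ω₁` serves.
      ... | no ¬n = em⇒dne em₀ ω₁-nonZero , λ n n∈X eq _ → ¬n (n , n∈X , eq)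
      ... | yes (n , n∈X , refl) with em {Σ[ a ∈ Ω.Carrier ] ¬ n ndrk≥ segment ω₁ a}
      ...   | yes (a , n≱a) = a , λ n′ _ eq n′≥a → n≱a
                (ndrk≥-⊑ n n′ (code-⊑ (proj₁ n) (proj₁ n′) (sym eq)) n′≥a)
      ...   | no ¬a = contradiction (limit ω₁-limit n≥) (X≱ω₁ n n∈X)
        where
        n≥ : ∀ β → β <ᵒ ω₁ → n ndrk≥ β
        n≥ β β<ω₁ with below a e ← <ᵒ⇒≺ β ω₁ β<ω₁ =
          ndrk≥-≼ n (inj₂ e) (em⇒dne em λ n≱a → ¬a (a , n≱a))

    ndrk≥ω₁-splits : (m : 𝐌 T ι) → m ndrk≥ ω₁ → ∀ ν → ν ∈ u (proj₁ m) → Splitting m ν ω₁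
    -- `X` is the class of all longer extensions of `m` that split `ν`.
    ndrk≥ω₁-splits m m≥ω₁ ν ν∈ = em⇒dne em λ ¬n →
      let (b , X≱b) = bounded-ndrk
            (λ n → Lift _ (ℓ (proj₁ m) ℕ.< ℓ (proj₁ n) × proj₁ m ⊑ proj₁ n × Splits ν (proj₁ n)))
            (λ n (lift (m<n , m⊑n , s)) n≥ω₁ → ¬n (n , m<n , m⊑n , n≥ω₁ , s))
          (n , m<n , m⊑n , n≥b , s) =
            ndrk≥-sucᵒ⁻¹ m (ndrk≥-≼ m (sucᵒ-least (segment≺ ω₁ b)) m≥ω₁) ν ν∈
      in X≱b n (lift (m<n , m⊑n , s)) n≥b

    -- Splitting reproduces the hypothesis in the extension, so every successor step can be taken
    -- and induction on `α` never gets stuck.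
    ndrk≥ω₁⇒∞ : (m : 𝐌 T ι) → m ndrk≥ ω₁ → ∀ α → m ndrk≥ α
    ndrk≥ω₁⇒∞ {T} {ι} m m≥ω₁ α = go (≺-wellFounded α) m m≥ω₁
      where
      go : ∀ {α} → Acc _≺_ α → (m : 𝐌 T ι) → m ndrk≥ ω₁ → m ndrk≥ α
      go {α} (acc rs) m m≥ω₁ with em₀ {IsZero α} | em {Σ[ β ∈ Ordinal ] α ≈ᵒ sucᵒ β}
      ... | yes α≡0 | _        = zero α≡0
      ... | no α≢0  | no α≢suc = limit (α≢0 , α≢suc) λ β β<α → go (rs (<ᵒ⇒≺ β α β<α)) m m≥ω₁
      ... | no _    | yes (β , e) = succ β e λ ν ν∈ →
        let (n , m<n , m⊑n , n≥ω₁ , s) = ndrk≥ω₁-splits m m≥ω₁ ν ν∈ in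
        n , m<n , m⊑n , go (rs (≺-respʳ (≅-sym (≈ᵒ⇒≅ α (sucᵒ β) e)) ≺-sucᵒ)) n n≥ω₁ , s

    -- An ordinal supremum `α` is refuted either way. A tuple of rank at least `ω₁` has rank ∞ and
    -- exceeds `α`; without one, some segment of `ω₁` bounds all the values `ndrk + 1`, hence also
    -- `α`, although `ω₁ ≤ α`.
    NDRK≥ω₁⇒∞ : [ ω₁ ] ≤⁺ NDRK em T ι → NDRK em T ι ≈⁺ ⊤⁺
    NDRK≥ω₁⇒∞ {T} {ι} ω₁≤
      with em {Σ[ α ∈ Ordinal ] IsSupremum (λ (m : 𝐌 T ι) → suc⁺ (ndrk em m)) [ α ]}
    ... | no _ = ⊤⁺≈⊤⁺
    ... | yes (α , upper , least-upper) with [ ω₁≤α ] ← ω₁≤ | em {Σ[ m ∈ 𝐌 T ι ] m ndrk≥ ω₁}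
    ...   | yes (m , m≥ω₁) = ⊥-elim (go (ndrk-isNdrk m) (upper m))
      where
      go : ∀ {v} → IsNdrk m v → ¬ suc⁺ v ≤⁺ [ α ]
      go {⊤⁺} _ ()
      go {[ β ]} (_ , m≤β) _ = ≺⇒⋡ ≺-sucᵒ
        (≤ᵒ⇒≼ (sucᵒ β) β (m≤β (sucᵒ β) (ndrk≥ω₁⇒∞ m m≥ω₁ (sucᵒ β))))
    ...   | no none = ⊥-elim (go (least-upper [ segment ω₁ (proj₁ bound) ] λ m → suc-ndrk≤ m (ndrk-isNdrk m)))
      where
      bound = bounded-ndrk {T} {ι} (λ _ → Lift _ ⊤) (λ n _ n≥ω₁ → none (n , n≥ω₁))

      suc-ndrk≤ : ∀ m {v} → IsNdrk m v → suc⁺ v ≤⁺ [ segment ω₁ (proj₁ bound) ]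
      suc-ndrk≤ m {⊤⁺}    m≥        = contradiction (m≥ _) (proj₂ bound m _)
      suc-ndrk≤ m {[ β ]} (m≥β , _) = [ ≼⇒≤ᵒ (sucᵒ-least (⋠⇒≻ λ b≼β →
        proj₂ bound m _ (ndrk≥-≼ m b≼β m≥β))) ]

      go : ¬ [ α ] ≤⁺ [ segment ω₁ (proj₁ bound) ]
      go [ α≤b ] = ≺⇒⋡ (segment≺ ω₁ (proj₁ bound))
        (≼-trans (≤ᵒ⇒≼ ω₁ α ω₁≤α) (≤ᵒ⇒≼ α (segment ω₁ (proj₁ bound)) α≤b))

lemma3p10 :
  (em : ExcludedMiddle (lsuc 0ℓ)) →
  (T : ℕ → Pred (List Bool) 0ℓ) → (∀ n → IsTree (T n)) → (∀ n → NoMaximalNodes (T n)) →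
  (ι : ℕ) → 2 ≤ ι →
  -- (1)
  IsPartialOrder {A = 𝐌 T ι} (_≋_ on proj₁) (_⊑_ on proj₁)
  -- (2)
  × ((m n : 𝐌 T ι) (α : Ordinal) → proj₁ m ⊑ proj₁ n →
      [ α ] ≤⁺ ndrk em n → [ α ] ≤⁺ ndrk em m)
  -- (3)
  × (((m : 𝐌 T ι) (α β : Ordinal) → β <ᵒ α → m ndrk≥ α → m ndrk≥ β)
      × ((m : 𝐌 T ι) → IsNdrk m (ndrk em m)))
  -- (4)
  × ((m : 𝐌 T ι) (ρ : ℕ → Bool) → ndrk em m ≈⁺ ndrk em (m +ᴹ ρ))
  -- (5)
  × ((ω₁ : Ordinal) → IsFirstUncountable ω₁ →
      (m : 𝐌 T ι) (ν : Vec Bool (ℓ (proj₁ m))) → ν ∈ u (proj₁ m) → [ ω₁ ] ≤⁺ ndrk em m →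
      Σ[ n ∈ 𝐌 T ι ] proj₁ m ⊑ proj₁ n × [ ω₁ ] ≤⁺ ndrk em n × Splits ν (proj₁ n))
  -- (6)
  × ((m : 𝐌 T ι) (α β : Ordinal) → ndrk em m ≈⁺ [ β ] → α <ᵒ β →
      Σ[ n ∈ 𝐌 T ι ] proj₁ m ⊑ proj₁ n × ndrk em n ≈⁺ [ α ])
  -- (7)
  × ((ω₁ : Ordinal) → IsFirstUncountable ω₁ → [ ω₁ ] ≤⁺ NDRK em T ι → NDRK em T ι ≈⁺ ⊤⁺)
  -- (8)
  × ((m : 𝐌 T ι) (u′ : Pred (Vec Bool (ℓ (proj₁ m))) 0ℓ) (u′⊆u : u′ ⊆ u (proj₁ m)) →
      AtLeastTwo u′ →
      Σ[ m′ ∈ Is𝐌 T ι (restrict (proj₁ m) u′ u′⊆u) ]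
        ndrk em m ≤⁺ ndrk em (restrict (proj₁ m) u′ u′⊆u , m′))
lemma3p10 em T _ _ ι _ =
    ⊑-isPartialOrder
  , (λ m n α m⊑n α≤n → ndrk≥⇒≤ndrk m (ndrk≥-⊑ m n m⊑n (≤ndrk⇒ndrk≥ n α≤n)))
  , ((λ m α β β<α m≥α → ndrk≥-≼ m (inj₁ (<ᵒ⇒≺ β α β<α)) m≥α) , ndrk-isNdrk)
  , (λ m ρ → ≤⁺-antisym (ndrk-mono m (m +ᴹ ρ) λ α → ndrk≥-+ᴹ m ρ)
                        (ndrk-mono (m +ᴹ ρ) m λ α m+≥α →
                          ndrk≥-⊑ m (m +ᴹ ρ +ᴹ ρ) (⊑-+ᴹ-+ᴹ m ρ) (ndrk≥-+ᴹ (m +ᴹ ρ) ρ m+≥α)))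
  , (λ ω₁ ω₁-first m ν ν∈ ω₁≤m →
      let open FirstUncountable ω₁ ω₁-first
          (n , _ , m⊑n , n≥ω₁ , s) = ndrk≥ω₁-splits m (≤ndrk⇒ndrk≥ m ω₁≤m) ν ν∈
      in n , m⊑n , ndrk≥⇒≤ndrk n n≥ω₁ , s)
  , smaller-ndrk
  , (λ ω₁ ω₁-first → FirstUncountable.NDRK≥ω₁⇒∞ ω₁ ω₁-first)
  , (λ m u′ u′⊆u ∣u′∣≥2 → restrict-Is𝐌 m u′ u′⊆u ∣u′∣≥2 ,
      ndrk-mono m (_ , restrict-Is𝐌 m u′ u′⊆u ∣u′∣≥2) λ α → ndrk≥-restrict m u′ u′⊆u ∣u′∣≥2)
  where open Classical em
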